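{- Let $n \geq 24$, and let \[ L = \{0, 2, 3, 7, 8, 9, 10\}, \qquad R = \{n-11, n-10, n-9, n-8, n-6, n-3, n-2, n-1\}. \] Let $M$ be a subset of $[11, n-12]$ with the property that every prefix and every suffix of the interval $[11, n-12]$ has more than half of its elements in $M$. Then $S = L \cup M \cup R$ is an MSTD set. The number of MSTD subsets of $\{0, 1, \dots, n-1\}$ obtained in this way (as $M$ ranges over all such subsets) is $\Theta(2^n/n)$.
   Context: For integers $a \le b$, $[a,b]$ denotes the set $\{a, a+1, \dots, b\}$. A more sums than differences (MSTD) set is a finite set $S$ of integers with $|S+S| > |S-S|$, where $S+S = \{s_1+s_2 : s_1,s_2\in S\}$ and $S-S = \{s_1-s_2 : s_1,s_2\in S\}$. A prefix of $[11, n-12]$ is an interval $[11, 10+k]$ and a suffix is an interval $[n-11-k, n-12]$, for $1 \le k \le n-22$. -}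

module Defs where

open import Data.Bool using (_∧_)
import Data.Bool.Properties as Bool
open import Data.Fin using (toℕ)
open import Data.Fin.Subset using (Subset; inside; outside; _⊆_; _∪_; _∩_; ∣_∣)
open import Data.Fin.Subset.Properties using (_∈?_; _⊆?_; anySubset?)
open import Data.Integer using (ℤ; +_)
import Data.Integer as ℤ
open import Data.List using (List; []; _∷_; _++_; map; filter; length; allFin; deduplicate; cartesianProductWith)
import Data.List.Membership.DecPropositional as ListMembership
open import Data.Nat using (ℕ; zero; suc; _+_; _*_; _∸_; _≤_; _<_; _>_; NonZero; s≤s; s≤s⁻¹)
open import Data.Nat.Properties using (_≟_; _≤?_; _<?_; allUpTo?)
open import Data.Product using (∃-syntax; _×_)
open import Data.Rational using (ℚ; 0ℚ)
import Data.Rational as ℚ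
import Data.Vec as Vec
import Data.Vec.Properties as Vec
open import Function using (_∘_)
open import Relation.Binary.PropositionalEquality using (_≡_)
open import Relation.Nullary using (Dec; does)
open import Relation.Nullary.Decidable using (map′; _×-dec_; _→-dec_)

-- A finite set of integers is represented by a list; order and repetitions
-- are irrelevant, since `card` counts distinct entries only.

card : List ℤ → ℕ
card = length ∘ deduplicate ℤ._≟_

_⊕_ : List ℤ → List ℤ → List ℤ
_⊕_ = cartesianProductWith ℤ._+_

_⊖_ : List ℤ → List ℤ → List ℤ
_⊖_ = cartesianProductWith ℤ._-_

MSTD : List ℤ → Set
MSTD S = card (S ⊕ S) > card (S ⊖ S)

-- `Subset n` is the type of subsets of {0, …, n-1}, an index i : Fin n
-- standing for the integer toℕ i.

elements : ∀ {n} → Subset n → List ℤ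
elements {n} S = map (λ i → + toℕ i) (filter (_∈? S) (allFin n))

fromList : ∀ {n} → List ℕ → Subset n
fromList xs = Vec.tabulate λ i → does (toℕ i ∈ₗ? xs)
  where open ListMembership _≟_ renaming (_∈?_ to _∈ₗ?_)

-- [a, b] ∩ {0, …, n-1}.
interval : ∀ {n} → ℕ → ℕ → Subset n
interval a b = Vec.tabulate λ i → does (a ≤? toℕ i) ∧ does (toℕ i ≤? b)

L : ∀ n → Subset n
L n = fromList (0 ∷ 2 ∷ 3 ∷ 7 ∷ 8 ∷ 9 ∷ 10 ∷ [])

-- Truncated subtraction is exact here, and in the definitions below, in the
-- range of interest n ≥ 24.
R : ∀ n → Subset n
R n = fromList (n ∸ 11 ∷ n ∸ 10 ∷ n ∸ 9 ∷ n ∸ 8 ∷ n ∸ 6 ∷ n ∸ 3 ∷ n ∸ 2 ∷ n ∸ 1 ∷ [])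

middle : ∀ n → Subset n
middle n = interval 11 (n ∸ 12)

prefix : ∀ n → ℕ → Subset n
prefix n k = interval 11 (10 + k)

suffix : ∀ n → ℕ → Subset n
suffix n k = interval (n ∸ 11 ∸ k) (n ∸ 12)

MoreThanHalfIn : ∀ {n} → Subset n → Subset n → Set
MoreThanHalfIn I M = 2 * ∣ I ∩ M ∣ > ∣ I ∣

PrefixSuffixProperty : ∀ {n} → Subset n → Set
PrefixSuffixProperty {n} M = ∀ k → 1 ≤ k → k ≤ n ∸ 22 →
  MoreThanHalfIn (prefix n k) M × MoreThanHalfIn (suffix n k) M

Obtained : ∀ {n} → Subset n → Set
Obtained {n} S = ∃[ M ] (M ⊆ middle n × PrefixSuffixProperty M × S ≡ L n ∪ M ∪ R n)

MSTD? : ∀ S → Dec (MSTD S)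
MSTD? S = card (S ⊖ S) <? card (S ⊕ S)

prefixSuffixProperty? : ∀ {n} (M : Subset n) → Dec (PrefixSuffixProperty M)
prefixSuffixProperty? {n} M =
  map′ to from (allUpTo? (λ k → (1 ≤? k) →-dec majority? k) (suc (n ∸ 22)))
  where
  Majority : ℕ → Set
  Majority k = MoreThanHalfIn (prefix n k) M × MoreThanHalfIn (suffix n k) M

  moreThanHalfIn? : ∀ I → Dec (MoreThanHalfIn I M)
  moreThanHalfIn? I = ∣ I ∣ <? 2 * ∣ I ∩ M ∣

  majority? : ∀ k → Dec (Majority k)
  majority? k = moreThanHalfIn? (prefix n k) ×-dec moreThanHalfIn? (suffix n k)

  to : (∀ {k} → k < suc (n ∸ 22) → 1 ≤ k → Majority k) → PrefixSuffixProperty M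
  to h k 1≤k k≤ = h (s≤s k≤) 1≤k

  from : PrefixSuffixProperty M → (∀ {k} → k < suc (n ∸ 22) → 1 ≤ k → Majority k)
  from h {k} k< 1≤k = h k 1≤k (s≤s⁻¹ k<)

obtained? : ∀ {n} (S : Subset n) → Dec (Obtained S)
obtained? {n} S = anySubset? λ M →
  (M ⊆? middle n) ×-dec prefixSuffixProperty? M ×-dec Vec.≡-dec Bool._≟_ S (L n ∪ M ∪ R n)

allSubsets : ∀ n → List (Subset n)
allSubsets zero    = Vec.[] ∷ []
allSubsets (suc n) = map (inside Vec.∷_) (allSubsets n) ++ map (outside Vec.∷_) (allSubsets n)

numberObtained : ℕ → ℕ
numberObtained n = length (filter (λ S → MSTD? (elements S) ×-dec obtained? S) (allSubsets n))

-- f = Θ(g) for nonnegative functions on the positive integers.  Rational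
-- constants lose no generality over positive real ones.
_=Θ_ : (f g : (n : ℕ) → .{{NonZero n}} → ℚ) → Set
f =Θ g = ∃[ c₁ ] ∃[ c₂ ] ∃[ N ] (0ℚ ℚ.< c₁ × 0ℚ ℚ.< c₂ ×
  (∀ n → .{{_ : NonZero n}} → N ≤ n → (c₁ ℚ.* g n ℚ.≤ f n) × (f n ℚ.≤ c₂ ℚ.* g n)))

{-# OPTIONS --safe #-}

-- Write n = m + 22 and code the middle part M by a bit vector v of length m.
--
-- MSTD: every window of {0, …, n-1} that starts at 0 or ends at n-1 and has
-- length at least 11 has more than half of its elements in S, so two of them
-- are symmetric about its centre.  Together with L + L and R + R near the ends
-- this gives all sums in [0, 2n-2] except 1.  The differences ±(n-7) are
-- missing, since they could only arise between L and R.
--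
-- Counting: reading v as a ±1 walk, let A_m be the number of walks all of whose
-- prefix sums are positive; A_{h+1} = C(h, ⌈h/2⌉) by reflection, so A_m² is of
-- order 4^m/m.  Both the prefix and the suffix condition are increasing in v, so by
-- Harris' inequality at least A_m²/2^m vectors satisfy both; restricting the
-- conditions to the first and last a = ⌊m/2⌋ entries, at most A_a² 2^(m-2a) do.
module Submission where

open import Defs
open import Data.Bool using (Bool; true; false; _∧_; _∨_; if_then_else_)
import Data.Bool.Properties as Bool
open import Data.Fin using (zero; suc; toℕ; fromℕ<)
open import Data.Fin.Properties using (toℕ-fromℕ<)
open import Data.Fin.Subset using (Subset; _∈_; _⊆_; _∪_; _∩_; ∣_∣; ⊤)
open import Data.Fin.Subset.Properties using (_∈?_; ∩-identityʳ)
import Data.Integer as ℤ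
import Data.Integer.Properties as ℤ
import Data.Integer.Tactic.RingSolver as ℤ
open import Data.List using (List; []; _∷_; length; filter; upTo; deduplicate)
import Data.List as List
import Data.List.Membership.DecPropositional as ListMembership
open import Data.List.Membership.Propositional using () renaming (_∈_ to _∈ₗ_; _∉_ to _∉ₗ_)
open import Data.List.Membership.Propositional.Properties
import Data.List.Properties as List
import Data.List.Relation.Binary.Subset.Propositional as List
open import Data.List.Relation.Unary.All using (All; []; _∷_)
import Data.List.Relation.Unary.All as All
import Data.List.Relation.Unary.All.Properties as All
open import Data.List.Relation.Unary.AllPairs using ([]; _∷_)
open import Data.List.Relation.Unary.Any using (here; there)
open import Data.List.Relation.Unary.Unique.DecPropositional.Properties ℤ._≟_ using (deduplicate-!)
open import Data.List.Relation.Unary.Unique.Propositional using (Unique)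
import Data.List.Relation.Unary.Unique.Propositional.Properties as Unique
open import Data.Nat hiding (_/_)
open import Data.Nat.Combinatorics using (_C_; nCk≡nC[n∸k]; nCn≡1; nC1≡n; nCk+nC[k+1]≡[n+1]C[k+1]; k>n⇒nCk≡0)
open import Data.Nat.Properties
open import Data.Nat.Tactic.RingSolver using (solve-∀)
open import Data.Product using (∃; ∃-syntax; _×_; _,_; proj₁; proj₂)
import Data.Rational as ℚ
import Data.Rational.Properties as ℚ
open import Data.Rational.Unnormalised using (mkℚᵘ; *≤*)
import Data.Rational.Unnormalised as ℚᵘ
import Data.Rational.Unnormalised.Properties as ℚᵘ
open import Data.Sum using (_⊎_; inj₁; inj₂; [_,_]′)
open import Data.Unit using (tt)
open import Data.Vec using (Vec; []; _∷_; _++_; _∷ʳ_; reverse; replicate; tabulate; here; there)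
open import Data.Vec.Properties using (reverse-∷; ∷-injective; ++-injectiveˡ; ++-injectiveʳ)
open import Function using (_∘_)
open import Relation.Binary.PropositionalEquality
open import Relation.Nullary using (Dec; yes; no; does; ¬_; contradiction)
open import Relation.Nullary.Decidable using (True; toWitness; dec-true; dec-false; from-yes; ¬?; _×-dec_; _⊎-dec_)
open import Relation.Unary using (Decidable)

-- The margin is one element: the sums fill at least 2n-2 integers, while [-(n-1), n-1] has 2n-1
-- elements and loses the pair ±(n-7), leaving at most 2n-3 differences. So no other sum may be
-- missed, however M is chosen within the condition. The gap at n-7 is independent of M: i - j = n-7
-- with i, j in [0, n-1] forces j < 7 and i ≥ n-7, so both elements lie in the fringes, where the
-- claim is a finite check. The majorities survive the fringes because these are themselves dense: L
-- fills 7 and R fills 8 of 11 places, and this surplus pays for strictness and for a window that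
-- cuts through the opposite fringe. In the count, the obstacle is that long prefixes and long
-- suffixes share coordinates, so the two conditions are not independent. Positive correlation is
-- the direction needed for the lower bound. For the upper bound, keeping only windows inside
-- disjoint halves restores independence, and halving the length changes the polynomial factor only
-- by a constant.

private variable
  m n : ℕ

-- Counting and indicator functions

bit : Bool → ℕ
bit b = if b then 1 else 0

-- Tallying Boolean functions on ℕ makes a window starting at `a` the plain shift `λ i → f (a + i)`,
-- with no change of index type.
tally : (ℕ → Bool) → ℕ → ℕ
tally f zero    = 0
tally f (suc k) = bit (f 0) + tally (f ∘ suc) k

tally-cong : ∀ {f g} k → (∀ i → i < k → f i ≡ g i) → tally f k ≡ tally g k
tally-cong zero    eq = refl
tally-cong (suc k) eq = cong₂ _+_ (cong bit (eq 0 z<s)) (tally-cong k λ i i<k → eq (suc i) (s<s i<k))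

bit-mono : ∀ {b c} → (b ≡ true → c ≡ true) → bit b ≤ bit c
bit-mono {false} h = z≤n
bit-mono {true}  h rewrite h refl = ≤-refl

tally-mono : ∀ {f g} k → (∀ i → f i ≡ true → g i ≡ true) → tally f k ≤ tally g k
tally-mono zero    f⇒g = z≤n
tally-mono (suc k) f⇒g = +-mono-≤ (bit-mono (f⇒g 0)) (tally-mono k (f⇒g ∘ suc))

tally-+ : ∀ f a b → tally f (a + b) ≡ tally f a + tally (λ i → f (a + i)) b
tally-+ f zero    b = refl
tally-+ f (suc a) b = trans (cong (bit (f 0) +_) (tally-+ (f ∘ suc) a b)) (sym (+-assoc (bit (f 0)) _ _))

tally-false : ∀ {f} k → (∀ i → i < k → f i ≡ false) → tally f k ≡ 0
tally-false zero    h = refl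
tally-false (suc k) h rewrite h 0 z<s = tally-false k λ i i<k → h (suc i) (s<s i<k)

tally-true : ∀ {f} k → (∀ i → i < k → f i ≡ true) → tally f k ≡ k
tally-true zero    h = refl
tally-true (suc k) h rewrite h 0 z<s = cong suc (tally-true k λ i i<k → h (suc i) (s<s i<k))

tally-suc : ∀ f k → tally f (suc k) ≡ bit (f k) + tally f k
tally-suc f zero    = refl
tally-suc f (suc k) = begin
  bit (f 0) + tally (f ∘ suc) (suc k)                ≡⟨ cong (bit (f 0) +_) (tally-suc (f ∘ suc) k) ⟩
  bit (f 0) + (bit (f (suc k)) + tally (f ∘ suc) k)  ≡⟨ x+[y+z]≡y+[x+z] (bit (f 0)) (bit (f (suc k))) _ ⟩
  bit (f (suc k)) + (bit (f 0) + tally (f ∘ suc) k)  ∎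
  where
  open ≡-Reasoning
  x+[y+z]≡y+[x+z] : ∀ x y z → x + (y + z) ≡ y + (x + z)
  x+[y+z]≡y+[x+z] = solve-∀

tally-reverse : ∀ f k → tally (λ i → f (k ∸ suc i)) k ≡ tally f k
tally-reverse f zero    = refl
tally-reverse f (suc k) = trans (cong (bit (f k) +_) (tally-reverse f k)) (sym (tally-suc f k))

-- Pigeonhole. Unless point 0 is common, dropping it lowers the two tallies by at most one in total,
-- so the strict inequality survives.
common-point : ∀ f g k → k < tally f k + tally g k → ∃[ i ] (i < k × f i ≡ true × g i ≡ true)
common-point f g (suc k) lt with f 0 in f0 | g 0 in g0
... | true  | true  = 0 , z<s , f0 , g0
... | true  | false = let i , i<k , p , q = common-point (f ∘ suc) (g ∘ suc) k (s<s⁻¹ lt) in suc i , s<s i<k , p , q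
... | false | true  =
  let i , i<k , p , q = common-point (f ∘ suc) (g ∘ suc) k (s<s⁻¹ (subst (suc k <_) (+-suc _ _) lt))
  in suc i , s<s i<k , p , q
... | false | false =
  let i , i<k , p , q = common-point (f ∘ suc) (g ∘ suc) k (<-trans (n<1+n k) lt) in suc i , s<s i<k , p , q

Majority : (ℕ → Bool) → ℕ → Set
Majority f k = k < 2 * tally f k

-- Among more than half of {0, …, k-1}, two elements are exchanged by i ↦ k-1-i.
majority⇒sum : ∀ f k → Majority f (suc k) → ∃[ i ] ∃[ j ] (f i ≡ true × f j ≡ true × i + j ≡ k)
majority⇒sum f k maj =
  let i , i<1+k , fi , fj = common-point f (λ i → f (k ∸ i)) (suc k) lt
  in i , k ∸ i , fi , fj , m+[n∸m]≡n (s≤s⁻¹ i<1+k)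
  where
  lt : suc k < tally f (suc k) + tally (λ i → f (k ∸ i)) (suc k)
  lt rewrite tally-reverse f (suc k) = subst (suc k <_) (cong (tally f (suc k) +_) (+-identityʳ _)) maj

-- The default `false` beyond the end lets membership alone bound the index, as in `χ-<`.
χ : ∀ {n} → Vec Bool n → ℕ → Bool
χ []      i       = false
χ (b ∷ v) zero    = b
χ (b ∷ v) (suc i) = χ v i

χ-< : ∀ {n} (v : Vec Bool n) {i} → χ v i ≡ true → i < n
χ-< (b ∷ v) {zero}  eq = z<s
χ-< (b ∷ v) {suc i} eq = s<s (χ-< v eq)

χ-injective : ∀ {n} {v w : Vec Bool n} → (∀ i → i < n → χ v i ≡ χ w i) → v ≡ w
χ-injective {v = []}    {[]}    eq = refl
χ-injective {v = b ∷ v} {c ∷ w} eq = cong₂ _∷_ (eq 0 z<s) (χ-injective λ i i<n → eq (suc i) (s<s i<n))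

χ-tabulate : ∀ {n} (f : ℕ → Bool) {i} → i < n → χ {n} (tabulate (f ∘ toℕ)) i ≡ f i
χ-tabulate {suc n} f {zero}  i<n = refl
χ-tabulate {suc n} f {suc i} i<n = χ-tabulate (f ∘ suc) (s<s⁻¹ i<n)

χ-∩ : ∀ {n} (p q : Subset n) i → χ (p ∩ q) i ≡ χ p i ∧ χ q i
χ-∩ []      []      i       = refl
χ-∩ (b ∷ p) (c ∷ q) zero    = refl
χ-∩ (b ∷ p) (c ∷ q) (suc i) = χ-∩ p q i

χ-∪ : ∀ {n} (p q : Subset n) i → χ (p ∪ q) i ≡ χ p i ∨ χ q i
χ-∪ []      []      i       = refl
χ-∪ (b ∷ p) (c ∷ q) zero    = refl
χ-∪ (b ∷ p) (c ∷ q) (suc i) = χ-∪ p q i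

χ-⊤ : ∀ n {i} → i < n → χ (⊤ {n}) i ≡ true
χ-⊤ (suc n) {zero}  i<n = refl
χ-⊤ (suc n) {suc i} i<n = χ-⊤ n (s<s⁻¹ i<n)

χ-++ˡ : ∀ {m n} (v : Vec Bool m) (w : Vec Bool n) {i} → i < m → χ (v ++ w) i ≡ χ v i
χ-++ˡ (b ∷ v) w {zero}  i<m = refl
χ-++ˡ (b ∷ v) w {suc i} i<m = χ-++ˡ v w (s<s⁻¹ i<m)

χ-++ʳ : ∀ {m n} (v : Vec Bool m) (w : Vec Bool n) i → χ (v ++ w) (m + i) ≡ χ w i
χ-++ʳ []      w i = refl
χ-++ʳ (b ∷ v) w i = χ-++ʳ v w i

χ-∷ʳ-< : ∀ {n} (v : Vec Bool n) b {i} → i < n → χ (v ∷ʳ b) i ≡ χ v i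
χ-∷ʳ-< (c ∷ v) b {zero}  i<n = refl
χ-∷ʳ-< (c ∷ v) b {suc i} i<n = χ-∷ʳ-< v b (s<s⁻¹ i<n)

χ-∷ʳ-last : ∀ {n} (v : Vec Bool n) b → χ (v ∷ʳ b) n ≡ b
χ-∷ʳ-last []      b = refl
χ-∷ʳ-last (c ∷ v) b = χ-∷ʳ-last v b

χ-reverse : ∀ {n} (v : Vec Bool n) {i} → i < n → χ (reverse v) (n ∸ suc i) ≡ χ v i
χ-reverse {suc n} (b ∷ v) {zero}  i<n rewrite reverse-∷ b v = χ-∷ʳ-last (reverse v) b
χ-reverse {suc n} (b ∷ v) {suc i} i<n rewrite reverse-∷ b v =
  trans (χ-∷ʳ-< (reverse v) b (∸-monoʳ-< {n} z<s (s<s⁻¹ i<n))) (χ-reverse v (s<s⁻¹ i<n))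

∣p∣≡tally : ∀ {n} (p : Subset n) → ∣ p ∣ ≡ tally (χ p) n
∣p∣≡tally []          = refl
∣p∣≡tally (true  ∷ p) = cong suc (∣p∣≡tally p)
∣p∣≡tally (false ∷ p) = ∣p∣≡tally p

χ-interval : ∀ {n} a b {i} → i < n → χ (interval {n} a b) i ≡ does (a ≤? i) ∧ does (i ≤? b)
χ-interval a b = χ-tabulate λ i → does (a ≤? i) ∧ does (i ≤? b)

χ-interval-∩ : ∀ {n} a b (M : Subset n) {i} → i < n →
               χ (interval a b ∩ M) i ≡ (does (a ≤? i) ∧ does (i ≤? b)) ∧ χ M i
χ-interval-∩ {n} a b M {i} i<n = trans (χ-∩ (interval a b) M i) (cong (_∧ χ M i) (χ-interval a b i<n))

-- The full tally is cut into three stretches, of which the outer two vanish. Both endpoints belong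
-- to the interval, hence `suc k` points.
∣interval∩M∣ : ∀ {n} (M : Subset n) a k → a + suc k ≤ n →
               ∣ interval a (a + k) ∩ M ∣ ≡ tally (λ i → χ M (a + i)) (suc k)
∣interval∩M∣ {n} M a k a+1+k≤n with c , refl ← m≤n⇒∃[o]m+o≡n a+1+k≤n = begin
  ∣ interval a (a + k) ∩ M ∣  ≡⟨ ∣p∣≡tally (interval a (a + k) ∩ M) ⟩
  tally f (a + suc k + c)     ≡⟨ tally-+ f (a + suc k) c ⟩
  tally f (a + suc k) + tally (λ i → f (a + suc k + i)) c
    ≡⟨ cong₂ _+_ (tally-+ f a (suc k)) (tally-false c above) ⟩
  tally f a + tally (λ i → f (a + i)) (suc k) + 0
    ≡⟨ +-identityʳ _ ⟩
  tally f a + tally (λ i → f (a + i)) (suc k)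
    ≡⟨ cong₂ _+_ (tally-false a below) (tally-cong (suc k) within) ⟩
  tally (λ i → χ M (a + i)) (suc k) ∎
  where
  open ≡-Reasoning
  f : ℕ → Bool
  f = χ (interval a (a + k) ∩ M)

  below : ∀ i → i < a → f i ≡ false
  below i i<a
    rewrite χ-interval-∩ a (a + k) M {i} (<-≤-trans i<a (≤-trans (m≤m+n a _) a+1+k≤n))
          | dec-false (a ≤? i) (<⇒≱ i<a) = refl

  above : ∀ i → i < c → f (a + suc k + i) ≡ false
  above i i<c
    rewrite χ-interval-∩ a (a + k) M {a + suc k + i} (+-monoʳ-< (a + suc k) i<c)
          | dec-false (a + suc k + i ≤? a + k)
              (<⇒≱ (<-≤-trans (+-monoʳ-< a (n<1+n k)) (m≤m+n (a + suc k) i)))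
          | Bool.∧-zeroʳ (does (a ≤? a + suc k + i)) = refl

  within : ∀ i → i < suc k → f (a + i) ≡ χ M (a + i)
  within i i<1+k
    rewrite χ-interval-∩ a (a + k) M {a + i} (<-≤-trans (+-monoʳ-< a i<1+k) a+1+k≤n)
          | dec-true (a ≤? a + i) (m≤m+n a i)
          | dec-true (a + i ≤? a + k) (+-monoʳ-≤ a (s≤s⁻¹ i<1+k)) = refl

∣interval∣ : ∀ {n} a k → a + suc k ≤ n → ∣ interval {n} a (a + k) ∣ ≡ suc k
∣interval∣ {n} a k a+1+k≤n = begin
  ∣ interval {n} a (a + k) ∣          ≡⟨ cong ∣_∣ (∩-identityʳ (interval {n} a (a + k))) ⟨
  ∣ interval {n} a (a + k) ∩ ⊤ ∣      ≡⟨ ∣interval∩M∣ (⊤ {n}) a k a+1+k≤n ⟩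
  tally (λ i → χ (⊤ {n}) (a + i)) (suc k)
    ≡⟨ tally-true (suc k) (λ i i<1+k → χ-⊤ n (<-≤-trans (+-monoʳ-< a i<1+k) a+1+k≤n)) ⟩
  suc k ∎
  where open ≡-Reasoning

-- Block structure of S

∈⇒χ : ∀ {n} {p : Subset n} {x} → x ∈ p → χ p (toℕ x) ≡ true
∈⇒χ here        = refl
∈⇒χ (there x∈p) = ∈⇒χ x∈p

χ⇒∈ : ∀ {n} {p : Subset n} {x} → χ p (toℕ x) ≡ true → x ∈ p
χ⇒∈ {p = true ∷ p} {zero}  refl = here
χ⇒∈ {p = b ∷ p}    {suc x} eq   = there (χ⇒∈ eq)

⊆⇒χ : ∀ {n} {p q : Subset n} → p ⊆ q → ∀ i → χ p i ≡ true → χ q i ≡ true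
⊆⇒χ {n} {p} {q} p⊆q i eq =
  subst (λ j → χ q j ≡ true) x≡i (∈⇒χ (p⊆q (χ⇒∈ (subst (λ j → χ p j ≡ true) (sym x≡i) eq))))
  where
  x≡i : toℕ (fromℕ< (χ-< p eq)) ≡ i
  x≡i = toℕ-fromℕ< (χ-< p eq)

χ⇒⊆ : ∀ {n} {p q : Subset n} → (∀ i → χ p i ≡ true → χ q i ≡ true) → p ⊆ q
χ⇒⊆ p⇒q {x} x∈p = χ⇒∈ (p⇒q (toℕ x) (∈⇒χ x∈p))

-- The ambient n is written as 11 + (m + 11), so that L, the middle interval
-- and R occupy consecutive blocks of a bit vector of length span m.
span : ℕ → ℕ
span m = 11 + (m + 11)

padding leftFringe rightFringe : Vec Bool 11
padding     = replicate 11 false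
leftFringe  = true ∷ false ∷ true ∷ true ∷ false ∷ false ∷ false ∷ true ∷ true ∷ true ∷ true ∷ []
rightFringe = true ∷ true ∷ true ∷ true ∷ false ∷ true ∷ false ∷ false ∷ true ∷ true ∷ true ∷ []

χ-replicate-false : ∀ n i → χ (replicate n false) i ≡ false
χ-replicate-false zero    i       = refl
χ-replicate-false (suc n) zero    = refl
χ-replicate-false (suc n) (suc i) = χ-replicate-false n i

χ-padding : ∀ i → χ padding i ≡ false
χ-padding = χ-replicate-false 11

padded : ∀ {m} → Vec Bool m → Subset (span m)
padded v = padding ++ (v ++ padding)

fringed : ∀ {m} → Vec Bool m → Subset (span m)
fringed v = leftFringe ++ (v ++ rightFringe)

-- A view of positions: matching on it rewrites an index as block start plus local index, the form
-- in which `χ-++ˡ` and `χ-++ʳ` apply.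
data Block (a b c : ℕ) : ℕ → Set where
  left   : ∀ {i} → i < a → Block a b c i
  centre : ∀ {i} → i < b → Block a b c (a + i)
  right  : ∀ {i} → i < c → Block a b c (a + (b + i))

block : ∀ a b c {i} → i < a + (b + c) → Block a b c i
block a b c {i} i<n with i <? a
... | yes i<a = left i<a
... | no  i≮a with j , refl ← m≤n⇒∃[o]m+o≡n (≮⇒≥ i≮a) with j <? b
...   | yes j<b = centre j<b
...   | no  j≮b with k , refl ← m≤n⇒∃[o]m+o≡n (≮⇒≥ j≮b) =
  right (+-cancelˡ-< b k c (+-cancelˡ-< a (b + k) (b + c) i<n))

-- The Boolean underlying the decision procedure for list membership. Unlike the fringe positions
-- themselves, it can be freed from the variable `m` by a common shift (`member-shift`), after which
-- it evaluates.
member : ℕ → List ℕ → Bool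
member i []       = false
member i (x ∷ xs) = (i ≡ᵇ x) ∨ member i xs

χ-fromList : ∀ {n} xs {i} → i < n → χ (fromList {n} xs) i ≡ member i xs
χ-fromList xs i<n = trans (χ-tabulate _ i<n) (does-∈? _ xs)
  where
  open ListMembership _≟_ using () renaming (_∈?_ to _∈ₗ?_)
  does-∈? : ∀ i xs → does (i ∈ₗ? xs) ≡ member i xs
  does-∈? i []       = refl
  does-∈? i (x ∷ xs) = cong ((i ≡ᵇ x) ∨_) (does-∈? i xs)

+-≡ᵇ : ∀ m i j → (m + i ≡ᵇ m + j) ≡ (i ≡ᵇ j)
+-≡ᵇ zero    i j = refl
+-≡ᵇ (suc m) i j = +-≡ᵇ m i j

member-shift : ∀ m i xs → member (m + i) (List.map (m +_) xs) ≡ member i xs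
member-shift m i []       = refl
member-shift m i (x ∷ xs) = cong₂ _∨_ (+-≡ᵇ m i x) (member-shift m i xs)

<⇒≢ᵇ : ∀ {i j} → i < j → (i ≡ᵇ j) ≡ false
<⇒≢ᵇ {zero}  {suc j} _         = refl
<⇒≢ᵇ {suc i} {suc j} (s<s i<j) = <⇒≢ᵇ i<j

member-above : ∀ {i xs} → All (i <_) xs → member i xs ≡ false
member-above []              = refl
member-above {i} (i<x ∷ i<s) rewrite <⇒≢ᵇ i<x = member-above i<s

-- Since n = m + 22, the element n - c of R is m + (22 - c); the offsets are these values 22 - c.
leftElements rightOffsets : List ℕ
leftElements = 0 ∷ 2 ∷ 3 ∷ 7 ∷ 8 ∷ 9 ∷ 10 ∷ []
rightOffsets = 11 ∷ 12 ∷ 13 ∷ 14 ∷ 16 ∷ 19 ∷ 20 ∷ 21 ∷ []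

span≡ : ∀ m → span m ≡ m + 22
span≡ m = trans (sym (+-assoc 11 m 11)) (trans (cong (_+ 11) (+-comm 11 m)) (+-assoc m 11 11))

span∸ : ∀ m c → c ≤ 22 → span m ∸ c ≡ m + (22 ∸ c)
span∸ m c c≤22 = trans (cong (_∸ c) (span≡ m)) (+-∸-assoc m c≤22)

R≡ : ∀ m → R (span m) ≡ fromList (List.map (m +_) rightOffsets)
R≡ m = cong fromList
  (cong₂ _∷_ (s 11) (cong₂ _∷_ (s 10) (cong₂ _∷_ (s 9) (cong₂ _∷_ (s 8)
  (cong₂ _∷_ (s 6) (cong₂ _∷_ (s 3) (cong₂ _∷_ (s 2) (cong (_∷ []) (s 1)))))))))
  where
  s : ∀ c {_ : True (c ≤? 22)} → span m ∸ c ≡ m + (22 ∸ c)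
  s c {c≤22} = span∸ m c (toWitness c≤22)

χ-R : ∀ m {i} → i < span m → χ (R (span m)) i ≡ member i (List.map (m +_) rightOffsets)
χ-R m {i} i<n = trans (cong (λ p → χ p i) (R≡ m)) (χ-fromList (List.map (m +_) rightOffsets) i<n)

χ-R-< : ∀ m {i} → i < m + 11 → χ (R (span m)) i ≡ false
χ-R-< m {i} i<m+11 = trans (χ-R m (<-≤-trans i<m+11 (m≤n+m (m + 11) 11))) (member-above (above rightOffsets 11≤))
  where
  11≤ : All (11 ≤_) rightOffsets
  11≤ = from-yes (All.all? (11 ≤?_) rightOffsets)
  above : ∀ xs → All (11 ≤_) xs → All (i <_) (List.map (m +_) xs)
  above []       []            = []
  above (x ∷ xs) (11≤x ∷ 11≤s) = <-≤-trans i<m+11 (+-monoʳ-≤ m 11≤x) ∷ above xs 11≤s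

fringed≡ : ∀ {m} (v : Vec Bool m) → L (span m) ∪ padded v ∪ R (span m) ≡ fringed v
fringed≡ {m} v = χ-injective pointwise
  where
  χ-∪∪ : ∀ i → i < span m → χ (L (span m) ∪ padded v ∪ R (span m)) i ≡ member i leftElements ∨ (χ (padded v) i ∨ χ (R (span m)) i)
  χ-∪∪ i i<n = trans (χ-∪ (L (span m)) (padded v ∪ R (span m)) i)
    (cong₂ _∨_ (χ-fromList leftElements i<n) (χ-∪ (padded v) (R (span m)) i))

  pointwise : ∀ i → i < span m → χ (L (span m) ∪ padded v ∪ R (span m)) i ≡ χ (fringed v) i
  pointwise i i<n = trans (χ-∪∪ i i<n) (rest (block 11 m 11 i<n) i<n)
    where
    -- Within a fringe only 11 positions remain and `m` has disappeared, so evaluation decides the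
    -- equality.
    onLeft : ∀ {i} → i < 11 → member i leftElements ∨ false ≡ χ leftFringe i
    onLeft = from-yes (allUpTo? (λ i → member i leftElements ∨ false Bool.≟ χ leftFringe i) 11)
    onRight : ∀ {i} → i < 11 → member (11 + i) rightOffsets ≡ χ rightFringe i
    onRight = from-yes (allUpTo? (λ i → member (11 + i) rightOffsets Bool.≟ χ rightFringe i) 11)
    components : ∀ {i} {a b c} → member i leftElements ≡ a → χ (padded v) i ≡ b → χ (R (span m)) i ≡ c →
                 member i leftElements ∨ (χ (padded v) i ∨ χ (R (span m)) i) ≡ a ∨ (b ∨ c)
    components eq₁ eq₂ eq₃ = cong₂ _∨_ eq₁ (cong₂ _∨_ eq₂ eq₃)
    rest : ∀ {i} → Block 11 m 11 i → i < span m → member i leftElements ∨ (χ (padded v) i ∨ χ (R (span m)) i) ≡ χ (fringed v) i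
    rest (left {i} i<11) _ = trans
      (components {i} refl (trans (χ-++ˡ padding (v ++ padding) i<11) (χ-padding i))
                       (χ-R-< m (<-≤-trans i<11 (m≤n+m 11 m))))
      (trans (onLeft i<11) (sym (χ-++ˡ leftFringe (v ++ rightFringe) i<11)))
    rest (centre {i} i<m) _ = trans
      (components {11 + i} refl (χ-++ˡ v padding i<m)
                       (χ-R-< m {11 + i} (subst (11 + i <_) (+-comm 11 m) (+-monoʳ-< 11 i<m))))
      (trans (Bool.∨-identityʳ _) (sym (χ-++ˡ v rightFringe i<m)))
    rest (right {i} i<11) i<n = trans
      (components {11 + (m + i)} refl (trans (χ-++ʳ v padding i) (χ-padding i)) (trans (χ-R m i<n) (begin
        member (11 + (m + i)) (List.map (m +_) rightOffsets)
          ≡⟨ cong (λ j → member j (List.map (m +_) rightOffsets)) 11+[m+i]≡m+[11+i] ⟩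
        member (m + (11 + i)) (List.map (m +_) rightOffsets)
          ≡⟨ member-shift m (11 + i) rightOffsets ⟩
        member (11 + i) rightOffsets
          ≡⟨ onRight i<11 ⟩
        χ rightFringe i ∎)))
      (sym (χ-++ʳ v rightFringe i))
      where
      open ≡-Reasoning
      11+[m+i]≡m+[11+i] : 11 + (m + i) ≡ m + (11 + i)
      11+[m+i]≡m+[11+i] = trans (sym (+-assoc 11 m i)) (trans (cong (_+ i) (+-comm 11 m)) (+-assoc m 11 i))

span∸12 : ∀ m → span m ∸ 12 ≡ 10 + m
span∸12 m = trans (span∸ m 12 (from-yes (12 ≤? 22))) (+-comm m 10)

χ-middle : ∀ m {i} → i < span m → χ (middle (span m)) i ≡ does (11 ≤? i) ∧ does (i ≤? 10 + m)
χ-middle m {i} i<n = trans (χ-interval 11 (span m ∸ 12) i<n) (cong (λ b → does (11 ≤? i) ∧ does (i ≤? b)) (span∸12 m))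

padded⊆middle : ∀ {m} (v : Vec Bool m) → padded v ⊆ middle (span m)
padded⊆middle {m} v = χ⇒⊆ λ i eq →
  let i<n = χ-< (padded v) {i} eq in trans (χ-middle m i<n) (inMiddle (block 11 m 11 i<n) eq)
  where
  inMiddle : ∀ {i} → Block 11 m 11 i → χ (padded v) i ≡ true → does (11 ≤? i) ∧ does (i ≤? 10 + m) ≡ true
  inMiddle (left {i} i<11) eq
    with () ← trans (sym (χ-padding i)) (trans (sym (χ-++ˡ padding (v ++ padding) i<11)) eq)
  inMiddle (centre {i} i<m) eq
    rewrite dec-true (11 ≤? 11 + i) (m≤m+n 11 i) = dec-true (11 + i ≤? 10 + m) (+-monoʳ-≤ 10 i<m)
  inMiddle (right {i} i<11) eq
    with () ← trans (sym (χ-padding i)) (trans (sym (χ-++ʳ v padding i)) eq)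

⊆middle⇒padded : ∀ m {M : Subset (span m)} → M ⊆ middle (span m) → ∃[ v ] M ≡ padded {m} v
⊆middle⇒padded m {M} M⊆ = v , χ-injective λ i i<n → pointwise (block 11 m 11 i<n) i<n
  where
  v : Vec Bool m
  v = tabulate λ i → χ M (11 + toℕ i)
  outside-false : ∀ {i} → i < span m → does (11 ≤? i) ∧ does (i ≤? 10 + m) ≡ false → χ M i ≡ false
  outside-false {i} i<n out = Bool.¬-not λ eq →
    contradiction (trans (sym (⊆⇒χ M⊆ i eq)) (trans (χ-middle m i<n) out)) λ ()
  pointwise : ∀ {i} → Block 11 m 11 i → i < span m → χ M i ≡ χ (padded v) i
  pointwise (left {i} i<11) i<n
    rewrite χ-++ˡ padding (v ++ padding) i<11 | χ-padding i
    = outside-false i<n (cong (_∧ does (i ≤? 10 + m)) (dec-false (11 ≤? i) (<⇒≱ i<11)))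
  pointwise (centre {i} i<m) i<n = sym (trans (χ-++ˡ v padding i<m) (χ-tabulate (λ i → χ M (11 + i)) i<m))
  pointwise (right {i} i<11) i<n
    rewrite χ-++ʳ v padding i | χ-padding i
    = outside-false i<n (trans (cong (does (11 ≤? 11 + (m + i)) ∧_)
        (dec-false (11 + (m + i) ≤? 10 + m) (<⇒≱ (+-monoʳ-≤ 11 (m≤m+n m i)))))
        (Bool.∧-zeroʳ (does (11 ≤? 11 + (m + i)))))

-- Prefix and suffix conditions in terms of the bit vector

PrefixMajority SuffixMajority : ∀ {m} → Vec Bool m → Set
PrefixMajority {m} v = ∀ {k} → k < m → Majority (χ v) (suc k)
SuffixMajority {m} v = ∀ {k} → k < m → Majority (λ i → χ v (m ∸ suc k + i)) (suc k)

-- An equality of types rather than an implication, so that one lemma serves both directions of the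
-- translation.
moreThanHalfIn-interval : ∀ {n} (M : Subset n) a k → a + suc k ≤ n →
  MoreThanHalfIn (interval a (a + k)) M ≡ Majority (λ i → χ M (a + i)) (suc k)
moreThanHalfIn-interval M a k a+1+k≤n = cong₂ (λ x y → x < 2 * y) (∣interval∣ a k a+1+k≤n) (∣interval∩M∣ M a k a+1+k≤n)

padded-window : ∀ {m} (v : Vec Bool m) d k → d + suc k ≤ m →
  MoreThanHalfIn (interval (11 + d) (11 + d + k)) (padded v) ≡ Majority (λ i → χ v (d + i)) (suc k)
padded-window {m} v d k d+1+k≤m = trans
  (moreThanHalfIn-interval (padded v) (11 + d) k (+-monoʳ-≤ 11 (≤-trans d+1+k≤m (m≤m+n m 11))))
  (cong (λ t → suc k < 2 * t) (tally-cong (suc k) λ i i<1+k →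
    χ-++ˡ v padding (<-≤-trans (+-monoʳ-< d i<1+k) d+1+k≤m)))

prefix-majority : ∀ {m} (v : Vec Bool m) {k} → k < m →
  MoreThanHalfIn (prefix (span m) (suc k)) (padded v) ≡ Majority (χ v) (suc k)
prefix-majority v {k} k<m = padded-window v 0 k k<m

suffix-majority : ∀ {m} (v : Vec Bool m) {k} → k < m →
  MoreThanHalfIn (suffix (span m) (suc k)) (padded v) ≡ Majority (λ i → χ v (m ∸ suc k + i)) (suc k)
suffix-majority {m} v {k} k<m = trans
  (cong₂ (λ a b → MoreThanHalfIn (interval a b) (padded v)) start end)
  (padded-window v (m ∸ suc k) k (≤-reflexive (m∸n+n≡m k<m)))
  where
  start : span m ∸ 11 ∸ suc k ≡ 11 + (m ∸ suc k)
  start = trans (cong (_∸ suc k) (+-comm m 11)) (+-∸-assoc 11 k<m)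
  end : span m ∸ 12 ≡ 11 + (m ∸ suc k) + k
  end = trans (span∸12 m) (cong (10 +_) (trans (sym (m∸n+n≡m k<m)) (+-suc (m ∸ suc k) k)))

psp⇒majorities : ∀ {m} (v : Vec Bool m) → PrefixSuffixProperty (padded v) → PrefixMajority v × SuffixMajority v
psp⇒majorities {m} v psp =
    (λ {k} k<m → subst (λ A → A) (prefix-majority v k<m) (proj₁ (at k<m)))
  , (λ {k} k<m → subst (λ A → A) (suffix-majority v k<m) (proj₂ (at k<m)))
  where
  at : ∀ {k} → k < m → MoreThanHalfIn (prefix (span m) (suc k)) (padded v) × MoreThanHalfIn (suffix (span m) (suc k)) (padded v)
  -- `span m ∸ 22` computes to `m + 11 ∸ 11`.
  at {k} k<m = psp (suc k) (s≤s z≤n) (subst (suc k ≤_) (sym (m+n∸n≡m m 11)) k<m)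

majorities⇒psp : ∀ {m} (v : Vec Bool m) → PrefixMajority v → SuffixMajority v → PrefixSuffixProperty (padded v)
majorities⇒psp {m} v pre suf (suc k) _ k≤ =
    subst (λ A → A) (sym (prefix-majority v k<m)) (pre k<m)
  , subst (λ A → A) (sym (suffix-majority v k<m)) (suf k<m)
  where
  k<m : k < m
  k<m = subst (suc k ≤_) (m+n∸n≡m m 11) k≤

-- Sums and differences of S

-- The allowance 2 is 2 * 7 - 12: L supplies 7 elements in 11 places, and strictness of the majority
-- costs one more.
right-tally : ∀ {i} → i < 12 → i ≤ 2 + 2 * tally (χ rightFringe) i
right-tally = from-yes (allUpTo? (λ i → i ≤? 2 + 2 * tally (χ rightFringe) i) 12)

-- The allowance 4 is 2 * 8 - 12, coming from the 8 elements of R.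
left-tally : ∀ {c} → c < 11 → 11 ∸ c ≤ 4 + 2 * tally (λ i → χ leftFringe (c + i)) (11 ∸ c)
left-tally = from-yes (allUpTo? (λ c → 11 ∸ c ≤? 4 + 2 * tally (λ i → χ leftFringe (c + i)) (11 ∸ c)) 11)

-- Short windows need not have a majority: {0, 1} has one element of S out of two. Small sums are
-- therefore found inside L + L by search.
left-sums : ∀ {k} → k < 11 → k ≡ 1 ⊎ ∃[ i ] (i < suc k × χ leftFringe i ≡ true × χ leftFringe (k ∸ i) ≡ true)
left-sums = from-yes (allUpTo? (λ k → (k ≟ 1) ⊎-dec
  anyUpTo? (λ i → (χ leftFringe i Bool.≟ true) ×-dec (χ leftFringe (k ∸ i) Bool.≟ true)) (suc k)) 11)

-- Mirror image at the top: `i` and `e ∸ i` are distances below n-1, so `e` is the distance of the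
-- sum below 2(n-1). Here there is no exception.
right-sums : ∀ {e} → e < 11 → ∃[ i ] (i < suc e × χ rightFringe (10 ∸ i) ≡ true × χ rightFringe (10 ∸ (e ∸ i)) ≡ true)
right-sums = from-yes (allUpTo? (λ e →
  anyUpTo? (λ i → (χ rightFringe (10 ∸ i) Bool.≟ true) ×-dec (χ rightFringe (10 ∸ (e ∸ i)) Bool.≟ true)) (suc e)) 11)

-- The difference n - 7 would need i ∈ L and n - 7 + i ∈ R.
no-fringe-difference : ∀ {i} → i < 7 → ¬ (χ leftFringe i ≡ true × χ rightFringe (4 + i) ≡ true)
no-fringe-difference =
  from-yes (allUpTo? (λ i → ¬? ((χ leftFringe i Bool.≟ true) ×-dec (χ rightFringe (4 + i) Bool.≟ true))) 7)

module Sums {m : ℕ} (v : Vec Bool m) (pre : PrefixMajority v) (suf : SuffixMajority v) where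

  s : ℕ → Bool
  s = χ (fringed v)

  s-left : ∀ {i} → i < 11 → s i ≡ χ leftFringe i
  s-left = χ-++ˡ leftFringe (v ++ rightFringe)

  s-centre : ∀ {i} → i < m → s (11 + i) ≡ χ v i
  s-centre = χ-++ˡ v rightFringe

  s-right : ∀ i → s (11 + (m + i)) ≡ χ rightFringe i
  s-right = χ-++ʳ v rightFringe

  prefix-half : ∀ {t} → t ≤ m → t ≤ 2 * tally (χ v) t
  prefix-half {zero}  _   = z≤n
  prefix-half {suc k} k<m = <⇒≤ (pre k<m)

  suffix-half : ∀ {d t} → d + t ≡ m → t ≤ 2 * tally (λ i → χ v (d + i)) t
  suffix-half {d} {zero}  _  = z≤n
  suffix-half {d} {suc k} eq =
    <⇒≤ (subst (λ c → suc k < 2 * tally (λ i → χ v (c + i)) (suc k)) m∸1+k≡d (suf (m+n≤o⇒n≤o d (≤-reflexive eq))))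
    where
    m∸1+k≡d : m ∸ suc k ≡ d
    m∸1+k≡d = trans (cong (_∸ suc k) (sym eq)) (m+n∸n≡m d (suc k))

  halves : ∀ {x y} a A B → x ≤ 2 * A → y ≤ a + 2 * B → x + y ≤ a + 2 * (A + B)
  halves a A B x≤ y≤ = ≤-trans (+-mono-≤ x≤ y≤) (≤-reflexive (collect a A B))
    where
    collect : ∀ a A B → 2 * A + (a + 2 * B) ≡ a + 2 * (A + B)
    collect = solve-∀

  -- A window that ends inside R contains all of M, so the majority at full length `m` combines with
  -- the partial tally of R.
  tally-low : ∀ {t} → t ≤ m + 11 → t ≤ 2 + 2 * tally (χ (v ++ rightFringe)) t
  tally-low {t} t≤ with t ≤? m
  ... | yes t≤m = ≤-trans (prefix-half t≤m) (≤-trans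
    (≤-reflexive (cong (2 *_) (sym (tally-cong t λ i i<t → s-centre (<-≤-trans i<t t≤m))))) (m≤n+m _ 2))
  ... | no  t≰m with i , refl ← m≤n⇒∃[o]m+o≡n (≰⇒≥ t≰m) = ≤-trans
    (halves 2 (tally (χ v) m) (tally (χ rightFringe) i) (prefix-half ≤-refl) (right-tally (s≤s (+-cancelˡ-≤ m i 11 t≤))))
    (≤-reflexive (cong (λ x → 2 + 2 * x) (sym (trans (tally-+ (χ (v ++ rightFringe)) m i)
      (cong₂ _+_ (tally-cong m λ i i<m → s-centre i<m) (tally-cong i λ j _ → s-right j))))))

  majority-low : ∀ {t} → t ≤ m + 11 → Majority s (11 + t)
  -- `tally s (11 + t)` evaluates on the left fringe to 7 plus the tally of the remaining entries.
  majority-low {t} t≤ = ≤-trans (+-monoʳ-≤ 12 (tally-low t≤)) (≤-reflexive (shift (tally (χ (v ++ rightFringe)) t)))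
    where
    shift : ∀ x → 12 + (2 + 2 * x) ≡ 2 * (7 + x)
    shift = solve-∀

  sum-low : ∀ {k} → k ≢ 1 → k < span m → ∃[ i ] ∃[ j ] (s i ≡ true × s j ≡ true × i + j ≡ k)
  sum-low {k} k≢1 k<n = [ small , large ]′ (<-≤-connex k 11)
    where
    small : k < 11 → ∃[ i ] ∃[ j ] (s i ≡ true × s j ≡ true × i + j ≡ k)
    small k<11 with left-sums k<11
    ... | inj₁ k≡1 = contradiction k≡1 k≢1
    ... | inj₂ (i , i≤k , l-i , l-j) =
      i , k ∸ i , trans (s-left (≤-<-trans (s≤s⁻¹ i≤k) k<11)) l-i
        , trans (s-left (≤-<-trans (m∸n≤m k i) k<11)) l-j , m+[n∸m]≡n (s≤s⁻¹ i≤k)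
    large : 11 ≤ k → ∃[ i ] ∃[ j ] (s i ≡ true × s j ≡ true × i + j ≡ k)
    large 11≤k = majority⇒sum s k (subst (Majority s) 11+t≡1+k
      (majority-low (+-cancelˡ-≤ 11 t (m + 11) (subst (_≤ span m) (sym 11+t≡1+k) k<n))))
      where
      t : ℕ
      t = suc k ∸ 11
      11+t≡1+k : 11 + t ≡ suc k
      11+t≡1+k = m+[n∸m]≡n (m≤n⇒m≤1+n 11≤k)

  tally-high-centre : ∀ {d t} → d + t ≡ m → t ≤ 4 + 2 * tally (λ i → s (11 + d + i)) t
  tally-high-centre {d} {t} d+t≡m = begin
    t                                         ≤⟨ suffix-half d+t≡m ⟩
    2 * tally (λ i → χ v (d + i)) t           ≡⟨ cong (2 *_) (tally-cong t onCentre) ⟨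
    2 * tally (λ i → s (11 + d + i)) t        ≤⟨ m≤n+m _ 4 ⟩
    4 + 2 * tally (λ i → s (11 + d + i)) t    ∎
    where
    open ≤-Reasoning
    onCentre : ∀ i → i < t → s (11 + d + i) ≡ χ v (d + i)
    onCentre i i<t = s-centre (<-≤-trans (+-monoʳ-< d i<t) (≤-reflexive d+t≡m))

  tally-high-left : ∀ {c} → c < 11 → 11 ∸ c + m ≤ 4 + 2 * tally (λ i → s (c + i)) (11 ∸ c + m)
  tally-high-left {c} c<11 = begin
    11 ∸ c + m                       ≡⟨ +-comm (11 ∸ c) m ⟩
    m + (11 ∸ c)                     ≤⟨ halves 4 B A (prefix-half ≤-refl) (left-tally c<11) ⟩
    4 + 2 * (B + A)                  ≡⟨ cong (λ x → 4 + 2 * x) (+-comm B A) ⟩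
    4 + 2 * (A + B)
      ≡⟨ cong (λ x → 4 + 2 * x) (cong₂ _+_ (tally-cong (11 ∸ c) onLeft) (tally-cong m onCentre)) ⟨
    4 + 2 * (tally (λ i → s (c + i)) (11 ∸ c) + tally (λ i → s (c + (11 ∸ c + i))) m)
      ≡⟨ cong (λ x → 4 + 2 * x) (tally-+ (λ i → s (c + i)) (11 ∸ c) m) ⟨
    4 + 2 * tally (λ i → s (c + i)) (11 ∸ c + m) ∎
    where
    open ≤-Reasoning
    A B : ℕ
    A = tally (λ i → χ leftFringe (c + i)) (11 ∸ c)
    B = tally (χ v) m
    c+[11∸c]≡11 : c + (11 ∸ c) ≡ 11
    c+[11∸c]≡11 = m+[n∸m]≡n (<⇒≤ c<11)
    onLeft : ∀ i → i < 11 ∸ c → s (c + i) ≡ χ leftFringe (c + i)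
    onLeft i i< = s-left (subst (c + i <_) c+[11∸c]≡11 (+-monoʳ-< c i<))
    onCentre : ∀ i → i < m → s (c + (11 ∸ c + i)) ≡ χ v i
    onCentre i i<m = trans (cong s (trans (sym (+-assoc c (11 ∸ c) i)) (cong (_+ i) c+[11∸c]≡11))) (s-centre i<m)

  -- This is the part before R of a window ending at n-1. Starting in L, it contains all of M;
  -- starting later, it is a suffix of M, possibly empty.
  tally-high : ∀ {c t} → c + t ≡ 11 + m → t ≤ 4 + 2 * tally (λ i → s (c + i)) t
  tally-high {c} {t} eq = [ onLeft , onCentre ]′ (<-≤-connex c 11)
    where
    Bound : ℕ → ℕ → Set
    Bound c t = t ≤ 4 + 2 * tally (λ i → s (c + i)) t
    onLeft : c < 11 → Bound c t
    onLeft c<11 = subst (Bound c) (+-cancelˡ-≡ c (11 ∸ c + m) t (trans (sym (+-assoc c (11 ∸ c) m))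
      (trans (cong (_+ m) (m+[n∸m]≡n (<⇒≤ c<11))) (sym eq)))) (tally-high-left c<11)
    onCentre : 11 ≤ c → Bound c t
    onCentre 11≤c = subst (λ c → Bound c t) 11+d≡c
      (tally-high-centre (+-cancelˡ-≡ 11 (c ∸ 11 + t) m (trans (cong (_+ t) 11+d≡c) eq)))
      where
      11+d≡c : 11 + (c ∸ 11) ≡ c
      11+d≡c = m+[n∸m]≡n 11≤c

  majority-high : ∀ {c t} → c + t ≡ 11 + m → Majority (λ i → s (c + i)) (t + 11)
  majority-high {c} {t} eq = begin
    suc (t + 11)                                    ≡⟨ +-suc t 11 ⟨
    t + 12                                          ≤⟨ +-monoˡ-≤ 12 (tally-high eq) ⟩
    4 + 2 * tally (λ i → s (c + i)) t + 12          ≡⟨ shift (tally (λ i → s (c + i)) t) ⟩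
    2 * (tally (λ i → s (c + i)) t + 8)             ≡⟨ cong (λ x → 2 * (tally (λ i → s (c + i)) t + x)) (tally-cong 11 onRight) ⟨
    2 * (tally (λ i → s (c + i)) t + tally (λ i → s (c + (t + i))) 11)
                                                    ≡⟨ cong (2 *_) (tally-+ (λ i → s (c + i)) t 11) ⟨
    2 * tally (λ i → s (c + i)) (t + 11)            ∎
    where
    open ≤-Reasoning
    shift : ∀ x → 4 + 2 * x + 12 ≡ 2 * (x + 8)
    shift = solve-∀
    onRight : ∀ i → i < 11 → s (c + (t + i)) ≡ χ rightFringe i
    onRight i _ = trans (cong s (trans (sym (+-assoc c t i)) (trans (cong (_+ i) eq) (+-assoc 11 m i)))) (s-right i)

  -- Here 2(m + 21) = 2(n-1) is the largest possible sum. For `e` at least 11, the last `e + 1`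
  -- places start at `c` = n-1-e, and a pair symmetric in that window has sum 2c + e = 2(n-1) - e.
  sum-high : ∀ {e} → e < span m → ∃[ i ] ∃[ j ] (s i ≡ true × s j ≡ true × i + j + e ≡ 2 * (m + 21))
  sum-high {e} e<n = [ small , large ]′ (<-≤-connex e 11)
    where
    open ≡-Reasoning
    small : e < 11 → ∃[ i ] ∃[ j ] (s i ≡ true × s j ≡ true × i + j + e ≡ 2 * (m + 21))
    small e<11 with i , i≤e , r-i , r-j ← right-sums e<11 =
      11 + (m + a) , 11 + (m + b) , trans (s-right a) r-i , trans (s-right b) r-j , (begin
        11 + (m + a) + (11 + (m + b)) + e
          ≡⟨ cong (11 + (m + a) + (11 + (m + b)) +_) (m+[n∸m]≡n (s≤s⁻¹ i≤e)) ⟨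
        11 + (m + a) + (11 + (m + b)) + (i + (e ∸ i))
          ≡⟨ shift m a b i (e ∸ i) ⟩
        2 * (m + 11) + (i + a + (e ∸ i + b))
          ≡⟨ cong (2 * (m + 11) +_) (cong₂ _+_ (m+[n∸m]≡n (≤-trans (s≤s⁻¹ i≤e) e≤10))
               (m+[n∸m]≡n (≤-trans (m∸n≤m e i) e≤10))) ⟩
        2 * (m + 11) + 20
          ≡⟨ collect m ⟩
        2 * (m + 21) ∎)
      where
      a b : ℕ
      a = 10 ∸ i
      b = 10 ∸ (e ∸ i)
      e≤10 : e ≤ 10
      e≤10 = s≤s⁻¹ e<11
      shift : ∀ m a b x y → 11 + (m + a) + (11 + (m + b)) + (x + y) ≡ 2 * (m + 11) + (x + a + (y + b))
      shift = solve-∀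
      collect : ∀ m → 2 * (m + 11) + 20 ≡ 2 * (m + 21)
      collect = solve-∀
    large : 11 ≤ e → ∃[ i ] ∃[ j ] (s i ≡ true × s j ≡ true × i + j + e ≡ 2 * (m + 21))
    large 11≤e =
      let i , j , s-i , s-j , i+j≡e = majority⇒sum (λ i → s (c + i)) e
                      (subst (Majority (λ i → s (c + i))) t+11≡1+e (majority-high {c} {t} (m∸n+n≡m t≤11+m))) in
      c + i , c + j , s-i , s-j , (begin
      c + i + (c + j) + e              ≡⟨ shift c i j e ⟩
      2 * c + (i + j) + e              ≡⟨ cong (λ x → 2 * c + x + e) i+j≡e ⟩
      2 * c + e + e                    ≡⟨ cong (λ x → 2 * c + x + x) e≡t+10 ⟩
      2 * c + (t + 10) + (t + 10)      ≡⟨ double c t ⟩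
      2 * (c + t + 10)                 ≡⟨ cong (λ x → 2 * (x + 10)) (m∸n+n≡m t≤11+m) ⟩
      2 * (11 + m + 10)                ≡⟨ cong (λ x → 2 * (x + 10)) (+-comm 11 m) ⟩
      2 * (m + 11 + 10)                ≡⟨ cong (2 *_) (+-assoc m 11 10) ⟩
      2 * (m + 21)                     ∎)
      where
      t c : ℕ
      t = suc e ∸ 11
      c = 11 + m ∸ t
      t+11≡1+e : t + 11 ≡ suc e
      t+11≡1+e = m∸n+n≡m (m≤n⇒m≤1+n 11≤e)
      e≡t+10 : e ≡ t + 10
      e≡t+10 = suc-injective (trans (sym t+11≡1+e) (+-suc t 10))
      t≤11+m : t ≤ 11 + m
      t≤11+m = +-cancelʳ-≤ 11 t (11 + m) (subst (_≤ 11 + m + 11) (sym t+11≡1+e) e<n)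
      shift : ∀ c i j e → c + i + (c + j) + e ≡ 2 * c + (i + j) + e
      shift = solve-∀
      double : ∀ c t → 2 * c + (t + 10) + (t + 10) ≡ 2 * (c + t + 10)
      double = solve-∀

  every-sum : ∀ {k} → k ≢ 1 → k ≤ 2 * (m + 21) → ∃[ i ] ∃[ j ] (s i ≡ true × s j ≡ true × i + j ≡ k)
  every-sum {k} k≢1 k≤ = [ sum-low k≢1 , high ]′ (<-≤-connex k (span m))
    where
    high : span m ≤ k → ∃[ i ] ∃[ j ] (s i ≡ true × s j ≡ true × i + j ≡ k)
    high n≤k =
      let i , j , s-i , s-j , eq = sum-high {2 * (m + 21) ∸ k} e<n in
      i , j , s-i , s-j , +-cancelʳ-≡ (2 * (m + 21) ∸ k) (i + j) k (trans eq (sym (m+[n∸m]≡n k≤)))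
      where
      bound : ∀ m → suc (2 * (m + 21)) + 1 ≡ (11 + (m + 11)) + (11 + (m + 11))
      bound = solve-∀
      e<n : 2 * (m + 21) ∸ k < span m
      e<n = m<n+o⇒m∸n<o (2 * (m + 21)) k (begin-strict
        2 * (m + 21)                <⟨ m<m+n (2 * (m + 21)) {1} z<s ⟩
        2 * (m + 21) + 1            ≤⟨ n≤1+n _ ⟩
        suc (2 * (m + 21)) + 1      ≡⟨ bound m ⟩
        span m + span m             ≤⟨ +-monoˡ-≤ (span m) n≤k ⟩
        k + span m                  ∎)
        where open ≤-Reasoning

  -- `m + 15` is n-7. From i < n follows j < 7, and i is then the entry `4 + j` of R.
  no-difference : ∀ {i j} → s i ≡ true → s j ≡ true → i ≢ j + (m + 15)
  no-difference {j = j} s-i s-j refl = no-fringe-difference j<7 (s-left′ , s-right′)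
    where
    swap : ∀ m j → j + (m + 15) ≡ 11 + (m + (4 + j))
    swap = solve-∀
    j<7 : j < 7
    j<7 = +-cancelˡ-< 4 j 7 (+-cancelˡ-< m (4 + j) 11 (+-cancelˡ-< 11 (m + (4 + j)) (m + 11)
      (subst (_< span m) (swap m j) (χ-< (fringed v) {j + (m + 15)} s-i))))
    s-left′ : χ leftFringe j ≡ true
    s-left′ = trans (sym (s-left (<-≤-trans j<7 (from-yes (7 ≤? 11))))) s-j
    s-right′ : χ rightFringe (4 + j) ≡ true
    s-right′ = trans (sym (s-right (4 + j))) (trans (cong s (sym (swap m j))) s-i)

-- Counting bit vectors

-- Branching on the first entry makes counting arguments inductions on the length, with
-- `P? ∘ (b ∷_)` as the slice at first entry `b`.
count : {P : Vec Bool n → Set} → Decidable P → ℕ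
count {zero}  P? = if does (P? []) then 1 else 0
count {suc n} P? = count (P? ∘ (true ∷_)) + count (P? ∘ (false ∷_))

length-filter-allSubsets : ∀ {n} {P : Subset n → Set} (P? : Decidable P) → length (filter P? (allSubsets n)) ≡ count P?
length-filter-allSubsets {zero} P? with P? []
... | yes _ = refl
... | no  _ = refl
length-filter-allSubsets {suc n} P? = begin
  length (filter P? (with-head true List.++ with-head false))
    ≡⟨ cong length (List.filter-++ P? (with-head true) (with-head false)) ⟩
  length (filter P? (with-head true) List.++ filter P? (with-head false))
    ≡⟨ List.length-++ (filter P? (with-head true)) ⟩
  length (filter P? (with-head true)) + length (filter P? (with-head false))
    ≡⟨ cong₂ _+_ (half true) (half false) ⟩
  count (P? ∘ (true ∷_)) + count (P? ∘ (false ∷_)) ∎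
  where
  open ≡-Reasoning
  with-head : Bool → List (Subset (suc n))
  with-head b = List.map (b ∷_) (allSubsets n)
  filter-map : ∀ b (xs : List (Subset n)) → length (filter P? (List.map (b ∷_) xs)) ≡ length (filter (P? ∘ (b ∷_)) xs)
  filter-map b List.[] = refl
  filter-map b (x List.∷ xs) with does (P? (b ∷ x))
  ... | true  = cong suc (filter-map b xs)
  ... | false = filter-map b xs
  half : ∀ b → length (filter P? (with-head b)) ≡ count (P? ∘ (b ∷_))
  half b = trans (filter-map b (allSubsets n)) (length-filter-allSubsets (P? ∘ (b ∷_)))

count-mono : ∀ {P Q : Vec Bool n → Set} (P? : Decidable P) (Q? : Decidable Q) → (∀ v → P v → Q v) → count P? ≤ count Q?
count-mono {zero} P? Q? P⇒Q with P? [] | Q? []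
... | no  _ | _      = z≤n
... | yes _ | yes _  = ≤-refl
... | yes p | no  ¬q = contradiction (P⇒Q [] p) ¬q
count-mono {suc n} P? Q? P⇒Q =
  +-mono-≤ (count-mono (P? ∘ (true ∷_)) (Q? ∘ (true ∷_)) (λ v → P⇒Q (true ∷ v)))
           (count-mono (P? ∘ (false ∷_)) (Q? ∘ (false ∷_)) (λ v → P⇒Q (false ∷ v)))

count-cong : ∀ {P Q : Vec Bool n → Set} (P? : Decidable P) (Q? : Decidable Q) →
             (∀ v → P v → Q v) → (∀ v → Q v → P v) → count P? ≡ count Q?
count-cong P? Q? P⇒Q Q⇒P = ≤-antisym (count-mono P? Q? P⇒Q) (count-mono Q? P? Q⇒P)

count-none : ∀ {P : Vec Bool n → Set} (P? : Decidable P) → (∀ v → ¬ P v) → count P? ≡ 0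
count-none {zero} P? none with P? []
... | yes p = contradiction p (none [])
... | no  _ = refl
count-none {suc n} P? none =
  cong₂ _+_ (count-none (P? ∘ (true ∷_)) (λ v → none (true ∷ v))) (count-none (P? ∘ (false ∷_)) (λ v → none (false ∷ v)))

count-all : ∀ {P : Vec Bool n → Set} (P? : Decidable P) → (∀ v → P v) → count P? ≡ 2 ^ n
count-all {zero} P? all with P? []
... | yes _ = refl
... | no ¬p = contradiction (all []) ¬p
count-all {suc n} P? all =
  cong₂ _+_ (count-all (P? ∘ (true ∷_)) (λ v → all (true ∷ v)))
            (trans (count-all (P? ∘ (false ∷_)) (λ v → all (false ∷ v))) (sym (+-identityʳ (2 ^ n))))

count-forced-head : ∀ {P : Vec Bool (suc n) → Set} (P? : Decidable P) b → (∀ c v → P (c ∷ v) → c ≡ b) →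
                    count P? ≡ count (P? ∘ (b ∷_))
count-forced-head P? true forced =
  trans (cong (count (P? ∘ (true ∷_)) +_) (count-none (P? ∘ (false ∷_)) λ v p → contradiction (forced false v p) λ ())) (+-identityʳ _)
count-forced-head P? false forced =
  cong (_+ count (P? ∘ (false ∷_))) (count-none (P? ∘ (true ∷_)) λ v p → contradiction (forced true v p) λ ())

count-++ˡ : ∀ {P : Vec Bool (m + n) → Set} (P? : Decidable P) (l : Vec Bool m) → (∀ u → P u → ∃[ v ] u ≡ l ++ v) →
            count P? ≡ count (P? ∘ (l ++_))
count-++ˡ P? []      forced = refl
count-++ˡ P? (b ∷ l) forced =
  trans (count-forced-head P? b λ c v p → proj₁ (∷-injective (proj₂ (forced (c ∷ v) p))))
        (count-++ˡ (P? ∘ (b ∷_)) l λ u p → let v , eq = forced (b ∷ u) p in v , proj₂ (∷-injective eq))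

count-singleton : ∀ {P : Vec Bool n → Set} (P? : Decidable P) r → (∀ u → P u → u ≡ r) →
                  count P? ≡ (if does (P? r) then 1 else 0)
count-singleton P? []      forced = refl
count-singleton P? (b ∷ r) forced =
  trans (count-forced-head P? b λ c v p → proj₁ (∷-injective (forced (c ∷ v) p)))
        (count-singleton (P? ∘ (b ∷_)) r λ u p → proj₂ (∷-injective (forced (b ∷ u) p)))

count-++ʳ : ∀ {P : Vec Bool (m + n) → Set} (P? : Decidable P) (r : Vec Bool n) → (∀ u → P u → ∃[ v ] u ≡ v ++ r) →
            count P? ≡ count {m} (λ v → P? (v ++ r))
count-++ʳ {zero}  P? r forced = count-singleton P? r λ { u p → helper (forced u p) }
  where
  helper : ∀ {u} → ∃[ v ] u ≡ v ++ r → u ≡ r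
  helper ([] , eq) = eq
count-++ʳ {suc m} {n} P? r forced = cong₂ _+_ (half true) (half false)
  where
  tail : ∀ {b} {u : Vec Bool (m + n)} → (∃ λ (v : Vec Bool (suc m)) → b ∷ u ≡ v ++ r) → ∃ λ (v : Vec Bool m) → u ≡ v ++ r
  tail (c ∷ v , eq) = v , proj₂ (∷-injective eq)
  half : ∀ b → count (P? ∘ (b ∷_)) ≡ count {m} (λ v → P? (b ∷ (v ++ r)))
  half b = count-++ʳ (P? ∘ (b ∷_)) r λ u p → tail (forced (b ∷ u) p)

-- Entries in disjoint blocks vary independently. The induction peels only the first block, and the
-- factor `count R?` distributes over the two branches.
count-product : ∀ m {P : Vec Bool (m + n) → Set} {Q : Vec Bool m → Set} {R : Vec Bool n → Set}
                (P? : Decidable P) (Q? : Decidable Q) (R? : Decidable R) →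
                (∀ u v → P (u ++ v) → Q u × R v) → count P? ≤ count Q? * count R?
count-product zero P? Q? R? split with Q? []
... | yes _ = ≤-trans (count-mono P? R? λ v p → proj₂ (split [] v p)) (m≤m+n _ 0)
... | no ¬q = ≤-reflexive (count-none P? λ v p → ¬q (proj₁ (split [] v p)))
count-product (suc m) P? Q? R? split = ≤-trans (+-mono-≤ (half true) (half false))
  (≤-reflexive (sym (*-distribʳ-+ (count R?) (count (Q? ∘ (true ∷_))) (count (Q? ∘ (false ∷_))))))
  where
  half : ∀ b → count (P? ∘ (b ∷_)) ≤ count (Q? ∘ (b ∷_)) * count R?
  half b = count-product m (P? ∘ (b ∷_)) (Q? ∘ (b ∷_)) R? λ u v → split (b ∷ u) v

-- Reversal turns the first entry into the last, so `count-reverse` needs the branching moved to the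
-- last entry.
count-∷ʳ : ∀ {P : Vec Bool (suc n) → Set} (P? : Decidable P) →
           count P? ≡ count (λ v → P? (v ∷ʳ true)) + count (λ v → P? (v ∷ʳ false))
count-∷ʳ {zero}  P? = refl
count-∷ʳ {suc n} P? = trans
  (cong₂ _+_ (count-∷ʳ (P? ∘ (true ∷_))) (count-∷ʳ (P? ∘ (false ∷_))))
  (interchange (count λ v → P? (true ∷ (v ∷ʳ true))) _ _ _)
  where
  interchange : ∀ a b c d → a + b + (c + d) ≡ a + c + (b + d)
  interchange = solve-∀

count-reverse : ∀ {P : Vec Bool n → Set} (P? : Decidable P) → count (P? ∘ reverse) ≡ count P?
count-reverse {zero}  P? = refl
count-reverse {suc n} {P} P? = trans (cong₂ _+_ (half true) (half false)) (sym (count-∷ʳ P?))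
  where
  half : ∀ b → count (λ v → P? (reverse (b ∷ v))) ≡ count (λ v → P? (v ∷ʳ b))
  half b = trans
    (count-cong (λ v → P? (reverse (b ∷ v))) (λ v → P? (reverse v ∷ʳ b))
      (λ v → subst P (reverse-∷ b v)) (λ v → subst P (sym (reverse-∷ b v))))
    (count-reverse (λ v → P? (v ∷ʳ b)))

-- Increasing properties and Harris' inequality

_≼_ : Vec Bool n → Vec Bool n → Set
v ≼ w = ∀ i → χ v i ≡ true → χ w i ≡ true

Increasing : (Vec Bool n → Set) → Set
Increasing P = ∀ v w → v ≼ w → P v → P w

∷-≼ : ∀ b {v w : Vec Bool n} → v ≼ w → (b ∷ v) ≼ (b ∷ w)
∷-≼ b v≼w zero    eq = eq
∷-≼ b v≼w (suc i) eq = v≼w i eq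

false∷≼true∷ : ∀ (v : Vec Bool n) → (false ∷ v) ≼ (true ∷ v)
false∷≼true∷ v zero    ()
false∷≼true∷ v (suc i) eq = eq

-- Chebyshev's sum inequality for two terms; the two sides differ by (a-b)(c-d), which is `x * y` in
-- the proof.
chebyshev : ∀ {a b c d} → b ≤ a → d ≤ c → (a + b) * (c + d) ≤ 2 * (a * c + b * d)
chebyshev {b = b} {d = d} b≤a d≤c with x , refl ← m≤n⇒∃[o]m+o≡n b≤a | y , refl ← m≤n⇒∃[o]m+o≡n d≤c =
  ≤-trans (m≤m+n _ (x * y)) (≤-reflexive (expand b x d y))
  where
  expand : ∀ b x d y → (b + x + b) * (d + y + d) + x * y ≡ 2 * ((b + x) * (d + y) + b * d)
  expand = solve-∀

-- Induction on the length: the inequality holds on each half determined by the first entry, and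
-- since both counts are at least as large on the `true` half, `chebyshev` merges the halves.
harris : ∀ {P Q : Vec Bool n → Set} (P? : Decidable P) (Q? : Decidable Q) → Increasing P → Increasing Q →
         count P? * count Q? ≤ 2 ^ n * count (λ v → P? v ×-dec Q? v)
harris {zero} P? Q? incP incQ with P? [] | Q? []
... | no  _ | _     = z≤n
... | yes _ | no  _ = z≤n
... | yes _ | yes _ = ≤-refl
harris {suc n} P? Q? incP incQ = begin
  (p true + p false) * (q true + q false)
    ≤⟨ chebyshev (count-mono (P? ∘ (false ∷_)) (P? ∘ (true ∷_)) λ v → incP _ _ (false∷≼true∷ v))
                 (count-mono (Q? ∘ (false ∷_)) (Q? ∘ (true ∷_)) λ v → incQ _ _ (false∷≼true∷ v)) ⟩
  2 * (p true * q true + p false * q false)      ≤⟨ *-monoʳ-≤ 2 (+-mono-≤ (half true) (half false)) ⟩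
  2 * (2 ^ n * pq true + 2 ^ n * pq false)       ≡⟨ cong (2 *_) (*-distribˡ-+ (2 ^ n) (pq true) (pq false)) ⟨
  2 * (2 ^ n * (pq true + pq false))             ≡⟨ *-assoc 2 (2 ^ n) (pq true + pq false) ⟨
  2 ^ suc n * (pq true + pq false)               ∎
  where
  open ≤-Reasoning
  p q pq : Bool → ℕ
  p  b = count (P? ∘ (b ∷_))
  q  b = count (Q? ∘ (b ∷_))
  pq b = count (λ v → P? (b ∷ v) ×-dec Q? (b ∷ v))
  half : ∀ b → p b * q b ≤ 2 ^ n * pq b
  half b = harris (P? ∘ (b ∷_)) (Q? ∘ (b ∷_)) (λ v w v≼w → incP _ _ (∷-≼ b {v} {w} v≼w)) (λ v w v≼w → incQ _ _ (∷-≼ b {v} {w} v≼w))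

-- Monotonicity, reversal and restriction of the two conditions

majority-mono : ∀ {f g} k → (∀ i → f i ≡ true → g i ≡ true) → Majority f k → Majority g k
majority-mono k f⇒g maj = <-≤-trans maj (*-monoʳ-≤ 2 (tally-mono k f⇒g))

prefixMajority-increasing : Increasing {n} PrefixMajority
prefixMajority-increasing v w v≼w pre {k} k<n = majority-mono (suc k) v≼w (pre k<n)

suffixMajority-increasing : Increasing {n} SuffixMajority
suffixMajority-increasing {n} v w v≼w suf {k} k<n = majority-mono (suc k) (λ i → v≼w (n ∸ suc k + i)) (suf k<n)

majority? : ∀ f k → Dec (Majority f k)
majority? f k = k <? 2 * tally f k

prefixMajority? : Decidable (PrefixMajority {n})
prefixMajority? {n} v = allUpTo? (λ k → majority? (χ v) (suc k)) n

suffixMajority? : Decidable (SuffixMajority {n})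
suffixMajority? {n} v = allUpTo? (λ k → majority? (λ i → χ v (n ∸ suc k + i)) (suc k)) n

majority-cong : ∀ f g k → tally f k ≡ tally g k → Majority f k → Majority g k
majority-cong f g k = subst (λ t → k < 2 * t)

-- A suffix read backwards is a prefix of the reversed vector, and a tally ignores the order of
-- reading.
tally-suffix≡tally-reverse : ∀ (v : Vec Bool n) {k} → k ≤ n → tally (λ i → χ v (n ∸ k + i)) k ≡ tally (χ (reverse v)) k
tally-suffix≡tally-reverse {n} v {k} k≤n = trans
  (tally-cong k λ i i<k → begin
    χ v (n ∸ k + i)                          ≡⟨ χ-reverse v (<n i i<k) ⟨
    χ (reverse v) (n ∸ suc (n ∸ k + i))      ≡⟨ cong (χ (reverse v)) (index i i<k) ⟩
    χ (reverse v) (k ∸ suc i)                ∎)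
  (tally-reverse (χ (reverse v)) k)
  where
  open ≡-Reasoning
  <n : ∀ i → i < k → n ∸ k + i < n
  <n i i<k = <-≤-trans (+-monoʳ-< (n ∸ k) i<k) (≤-reflexive (m∸n+n≡m k≤n))
  index : ∀ i → i < k → n ∸ suc (n ∸ k + i) ≡ k ∸ suc i
  index i i<k = begin
    n ∸ suc (n ∸ k + i)        ≡⟨ cong (n ∸_) (+-suc (n ∸ k) i) ⟨
    n ∸ (n ∸ k + suc i)        ≡⟨ ∸-+-assoc n (n ∸ k) (suc i) ⟨
    n ∸ (n ∸ k) ∸ suc i        ≡⟨ cong (_∸ suc i) (m∸[m∸n]≡n k≤n) ⟩
    k ∸ suc i                  ∎

count-suffixMajority : ∀ n → count (suffixMajority? {n}) ≡ count (prefixMajority? {n})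
count-suffixMajority n = trans
  (count-cong {n} suffixMajority? (prefixMajority? ∘ reverse)
    (λ v suf {k} k<n → majority-cong (λ i → χ v (n ∸ suc k + i)) (χ (reverse v)) (suc k) (tally-suffix≡tally-reverse v k<n) (suf k<n))
    (λ v pre {k} k<n → majority-cong (χ (reverse v)) (λ i → χ v (n ∸ suc k + i)) (suc k) (sym (tally-suffix≡tally-reverse v k<n)) (pre k<n)))
  (count-reverse {n} prefixMajority?)

ballots : ℕ → ℕ
ballots n = count (prefixMajority? {n})

bidirectional? : Decidable (λ (v : Vec Bool n) → PrefixMajority v × SuffixMajority v)
bidirectional? v = prefixMajority? v ×-dec suffixMajority? v

ballots²≤ : ∀ n → ballots n * ballots n ≤ 2 ^ n * count (bidirectional? {n})
ballots²≤ n = ≤-trans (≤-reflexive (cong (ballots n *_) (sym (count-suffixMajority n))))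
  (harris {n} prefixMajority? suffixMajority? prefixMajority-increasing suffixMajority-increasing)

prefixMajority-++ : ∀ (u : Vec Bool m) (v : Vec Bool n) → PrefixMajority (u ++ v) → PrefixMajority u
prefixMajority-++ {m} {n} u v pre {k} k<m = majority-cong (χ (u ++ v)) (χ u) (suc k)
  (tally-cong (suc k) λ i i<1+k → χ-++ˡ u v (<-≤-trans i<1+k k<m)) (pre (≤-trans k<m (m≤m+n m n)))

suffixMajority-++ : ∀ (u : Vec Bool m) (v : Vec Bool n) → SuffixMajority (u ++ v) → SuffixMajority v
suffixMajority-++ {m} {n} u v suf {k} k<n =
  majority-cong (λ i → χ (u ++ v) (m + n ∸ suc k + i)) (λ i → χ v (n ∸ suc k + i)) (suc k)
  (tally-cong (suc k) λ i _ → trans (cong (χ (u ++ v)) (index i)) (χ-++ʳ u v (n ∸ suc k + i)))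
  (suf (≤-trans k<n (m≤n+m n m)))
  where
  index : ∀ i → m + n ∸ suc k + i ≡ m + (n ∸ suc k + i)
  index i = trans (cong (_+ i) (+-∸-assoc m k<n)) (+-assoc m (n ∸ suc k) i)

-- The `c` entries between the two outer blocks are left free; with `c` equal to 0 or 1 this shape
-- covers both parities of the length.
bidirectional≤ : ∀ a c → count (bidirectional? {a + (c + a)}) ≤ ballots a * (2 ^ c * ballots a)
bidirectional≤ a c = begin
  count (bidirectional? {a + (c + a)})
    ≤⟨ count-product a bidirectional? prefixMajority? suffixMajority?
         (λ u v (pre , suf) → prefixMajority-++ u v pre , suffixMajority-++ u v suf) ⟩
  ballots a * count (suffixMajority? {c + a})
    ≤⟨ *-monoʳ-≤ (ballots a) (count-product c suffixMajority? (λ _ → yes tt) suffixMajority?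
         (λ u v suf → tt , suffixMajority-++ u v suf)) ⟩
  ballots a * (count {c} (λ _ → yes tt) * count (suffixMajority? {a}))
    ≡⟨ cong (ballots a *_) (cong₂ _*_ (count-all {c} (λ _ → yes tt) (λ _ → tt)) (count-suffixMajority a)) ⟩
  ballots a * (2 ^ c * ballots a) ∎
  where open ≤-Reasoning

-- Ballot numbers

-- The walk starts at height `j`; its height after `suc k` steps is j + 2 * tally - suc k, written
-- without subtraction.
Nonnegative : ℕ → Vec Bool n → Set
Nonnegative {n} j v = ∀ {k} → k < n → suc k ≤ j + 2 * tally (χ v) (suc k)

nonnegative? : ∀ j → Decidable (Nonnegative {n} j)
nonnegative? {n} j v = allUpTo? (λ k → suc k ≤? j + 2 * tally (χ v) (suc k)) n

private
  double-suc : ∀ j x → j + 2 * (1 + x) ≡ suc (suc j + 2 * x)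
  double-suc = solve-∀

nonnegative-up⁻ : ∀ j (v : Vec Bool n) → Nonnegative j (true ∷ v) → Nonnegative (suc j) v
nonnegative-up⁻ j v nn {k} k<n = s≤s⁻¹ (subst (suc (suc k) ≤_) (double-suc j (tally (χ v) (suc k))) (nn (s<s k<n)))

nonnegative-up⁺ : ∀ j (v : Vec Bool n) → Nonnegative (suc j) v → Nonnegative j (true ∷ v)
nonnegative-up⁺ j v nn {zero}  _   = subst (1 ≤_) (sym (double-suc j 0)) (s≤s z≤n)
nonnegative-up⁺ j v nn {suc k} k<n = subst (suc (suc k) ≤_) (sym (double-suc j (tally (χ v) (suc k)))) (s≤s (nn (s<s⁻¹ k<n)))

nonnegative-down⁻ : ∀ j (v : Vec Bool n) → Nonnegative (suc j) (false ∷ v) → Nonnegative j v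
nonnegative-down⁻ j v nn k<n = s≤s⁻¹ (nn (s<s k<n))

nonnegative-down⁺ : ∀ j (v : Vec Bool n) → Nonnegative j v → Nonnegative (suc j) (false ∷ v)
nonnegative-down⁺ j v nn {zero}  _   = s≤s z≤n
nonnegative-down⁺ j v nn {suc k} k<n = s≤s (nn (s<s⁻¹ k<n))

-- The prefix of length 1 forces an up-step to height 1. Staying positive from there is staying
-- nonnegative after lowering the walk by 1.
ballots-suc : ∀ n → ballots (suc n) ≡ count (nonnegative? {n} 0)
ballots-suc n = trans
  (cong₂ _+_ (count-cong {n} (prefixMajority? ∘ (true ∷_)) (nonnegative? 0) to from)
             (count-none {n} (prefixMajority? ∘ (false ∷_)) λ v pre → contradiction (pre z<s) λ ()))
  (+-identityʳ _)
  where
  to : ∀ v → PrefixMajority (true ∷ v) → Nonnegative 0 v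
  to v pre {k} k<n = s≤s⁻¹ (s≤s⁻¹ (subst (3 + k ≤_) (double-suc 0 (tally (χ v) (suc k))) (pre (s<s k<n))))
  from : ∀ v → Nonnegative 0 v → PrefixMajority (true ∷ v)
  from v nn {zero}  _   = ≤-refl
  from v nn {suc k} k<n = subst (3 + k ≤_) (sym (double-suc 0 (tally (χ v) (suc k)))) (s≤s (s≤s (nn (s<s⁻¹ k<n))))

-- Reflection principle: of the ±1 walks S of length h, as many start at height
-- j and stay nonnegative as satisfy -j ≤ S_h ≤ j+1.  The final values -i and
-- i+1 are grouped into one summand, since only one of them has the parity of h.
reflected : ℕ → ℕ → ℕ
reflected h zero    = h C ⌈ h /2⌉
reflected h (suc j) = reflected h j + h C ⌈ h + suc j /2⌉

C-half-sym : ∀ h → h C ⌊ h /2⌋ ≡ h C ⌈ h /2⌉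
C-half-sym h = trans (nCk≡nC[n∸k] (⌊n/2⌋≤n h)) (cong (h C_)
  (trans (cong (_∸ ⌊ h /2⌋) (sym (⌊n/2⌋+⌈n/2⌉≡n h))) (m+n∸m≡n ⌊ h /2⌋ ⌈ h /2⌉)))

-- The boundary case of the walk recurrence: at height 0 only the up-step is allowed.
reflected-zero : ∀ h → reflected (suc h) 0 ≡ reflected h 1
reflected-zero h = begin
  suc h C suc ⌊ h /2⌋                          ≡⟨ nCk+nC[k+1]≡[n+1]C[k+1] h ⌊ h /2⌋ ⟨
  h C ⌊ h /2⌋ + h C suc ⌊ h /2⌋                ≡⟨ cong₂ _+_ (C-half-sym h) (cong (λ x → h C ⌈ x /2⌉) (+-comm 1 h)) ⟩
  h C ⌈ h /2⌉ + h C ⌈ h + 1 /2⌉                ∎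
  where open ≡-Reasoning

-- Pascal's rule splits the summand of index i ≥ 1 into those of indices i-1 and i+1. Summed over i,
-- this is the first step of a walk from height j+1, up to j+2 or down to j.
reflected-suc : ∀ h j → reflected (suc h) (suc j) ≡ reflected h (suc (suc j)) + reflected h j
reflected-suc h j = go j
  where
  open ≡-Reasoning
  regroup : ∀ a b c d → a + b + (c + d) ≡ (a + d) + (b + c)
  regroup = solve-∀
  pascal : ∀ j → suc h C ⌈ suc h + suc j /2⌉ ≡ h C ⌈ h + j /2⌉ + h C ⌈ h + suc (suc j) /2⌉
  pascal j = begin
    suc h C ⌈ suc h + suc j /2⌉                    ≡⟨ cong (λ x → suc h C ⌈ suc x /2⌉) (+-suc h j) ⟩
    suc h C suc ⌈ h + j /2⌉                        ≡⟨ nCk+nC[k+1]≡[n+1]C[k+1] h ⌈ h + j /2⌉ ⟨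
    h C ⌈ h + j /2⌉ + h C suc ⌈ h + j /2⌉          ≡⟨ cong (λ x → h C ⌈ h + j /2⌉ + h C ⌈ x /2⌉) (trans (+-suc h (suc j)) (cong suc (+-suc h j))) ⟨
    h C ⌈ h + j /2⌉ + h C ⌈ h + suc (suc j) /2⌉    ∎
  go : ∀ j → reflected (suc h) (suc j) ≡ reflected h (suc (suc j)) + reflected h j
  go zero = begin
    reflected (suc h) 0 + suc h C ⌈ suc h + 1 /2⌉
      ≡⟨ cong₂ _+_ (trans (reflected-zero h) (sym (+-identityʳ _))) (pascal 0) ⟩
    reflected h 1 + 0 + (h C ⌈ h + 0 /2⌉ + h C ⌈ h + 2 /2⌉)
      ≡⟨ regroup (reflected h 1) 0 _ _ ⟩
    reflected h 2 + h C ⌈ h + 0 /2⌉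
      ≡⟨ cong (λ x → reflected h 2 + h C ⌈ x /2⌉) (+-identityʳ h) ⟩
    reflected h 2 + reflected h 0 ∎
  go (suc j) = begin
    reflected (suc h) (suc j) + suc h C ⌈ suc h + suc (suc j) /2⌉
      ≡⟨ cong₂ _+_ (go j) (pascal (suc j)) ⟩
    reflected h (suc (suc j)) + reflected h j + (h C ⌈ h + suc j /2⌉ + h C ⌈ h + suc (suc (suc j)) /2⌉)
      ≡⟨ regroup (reflected h (suc (suc j))) _ _ _ ⟩
    reflected h (suc (suc (suc j))) + reflected h (suc j) ∎

reflected-base : ∀ j → reflected 0 j ≡ 1
reflected-base zero    = refl
reflected-base (suc j) = trans (cong₂ _+_ (reflected-base j) (k>n⇒nCk≡0 (z<s {⌊ j /2⌋}))) (+-identityʳ 1)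

count-nonnegative : ∀ h j → count (nonnegative? {h} j) ≡ reflected h j
count-nonnegative zero j = trans (count-all (nonnegative? {0} j) (λ _ ())) (sym (reflected-base j))
count-nonnegative (suc h) zero = begin
  count (nonnegative? {suc h} 0)
    ≡⟨ cong₂ _+_ (count-cong {h} (nonnegative? 0 ∘ (true ∷_)) (nonnegative? 1) (nonnegative-up⁻ 0) (nonnegative-up⁺ 0))
                 (count-none {h} (nonnegative? 0 ∘ (false ∷_)) λ v nn → contradiction (nn z<s) λ ()) ⟩
  count (nonnegative? {h} 1) + 0      ≡⟨ +-identityʳ _ ⟩
  count (nonnegative? {h} 1)          ≡⟨ count-nonnegative h 1 ⟩
  reflected h 1                       ≡⟨ reflected-zero h ⟨
  reflected (suc h) 0                 ∎
  where open ≡-Reasoning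
count-nonnegative (suc h) (suc j) = begin
  count (nonnegative? {suc h} (suc j))
    ≡⟨ cong₂ _+_
         (count-cong {h} (nonnegative? (suc j) ∘ (true ∷_)) (nonnegative? (suc (suc j))) (nonnegative-up⁻ (suc j)) (nonnegative-up⁺ (suc j)))
         (count-cong {h} (nonnegative? (suc j) ∘ (false ∷_)) (nonnegative? j) (nonnegative-down⁻ j) (nonnegative-down⁺ j)) ⟩
  count (nonnegative? {h} (suc (suc j))) + count (nonnegative? {h} j)
    ≡⟨ cong₂ _+_ (count-nonnegative h (suc (suc j))) (count-nonnegative h j) ⟩
  reflected h (suc (suc j)) + reflected h j
    ≡⟨ reflected-suc h j ⟨
  reflected (suc h) (suc j) ∎
  where open ≡-Reasoning

ballots≡C : ∀ h → ballots (suc h) ≡ h C ⌈ h /2⌉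
ballots≡C h = trans (ballots-suc h) (count-nonnegative h 0)

-- Bounds on central binomial coefficients

nC0≡1 : ∀ n → n C 0 ≡ 1
nC0≡1 n = trans (nCk≡nC[n∸k] {0} {n} z≤n) (nCn≡1 n)

C-absorption : ∀ n k → suc k * (suc n C suc k) ≡ suc n * (n C k)
C-absorption n zero = trans (*-identityˡ (suc n C 1)) (trans (nC1≡n (suc n)) (sym (trans (cong (suc n *_) (nC0≡1 n)) (*-identityʳ (suc n)))))
C-absorption zero (suc k) = trans (cong (suc (suc k) *_) (k>n⇒nCk≡0 (s<s (z<s {k}))))
  (trans (*-zeroʳ (suc (suc k))) (sym (cong (1 *_) (k>n⇒nCk≡0 (z<s {k})))))
C-absorption (suc n) (suc k) = begin
  suc (suc k) * (suc (suc n) C suc (suc k))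
    ≡⟨ cong (suc (suc k) *_) (nCk+nC[k+1]≡[n+1]C[k+1] (suc n) (suc k)) ⟨
  suc (suc k) * (suc n C suc k + suc n C suc (suc k))
    ≡⟨ expand (suc k) (suc n C suc k) (suc n C suc (suc k)) ⟩
  suc k * (suc n C suc k) + suc (suc k) * (suc n C suc (suc k)) + suc n C suc k
    ≡⟨ cong₂ (λ x y → x + y + suc n C suc k) (C-absorption n k) (C-absorption n (suc k)) ⟩
  suc n * (n C k) + suc n * (n C suc k) + suc n C suc k
    ≡⟨ cong (_+ suc n C suc k) (*-distribˡ-+ (suc n) (n C k) (n C suc k)) ⟨
  suc n * (n C k + n C suc k) + suc n C suc k
    ≡⟨ cong (λ x → suc n * x + suc n C suc k) (nCk+nC[k+1]≡[n+1]C[k+1] n k) ⟩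
  suc n * (suc n C suc k) + suc n C suc k
    ≡⟨ +-comm (suc n * (suc n C suc k)) _ ⟩
  suc (suc n) * (suc n C suc k) ∎
  where
  open ≡-Reasoning
  expand : ∀ k x y → suc k * (x + y) ≡ k * x + suc k * y + x
  expand = solve-∀

central : ℕ → ℕ
central k = (k + k) C k

-- The two entries above a central coefficient in Pascal's triangle are mirror images, hence equal.
central-suc : ∀ k → central (suc k) ≡ 2 * (suc (k + k) C suc k)
central-suc k = begin
  (suc k + suc k) C suc k                              ≡⟨ cong (λ x → suc x C suc k) (+-suc k k) ⟩
  suc (suc (k + k)) C suc k                            ≡⟨ nCk+nC[k+1]≡[n+1]C[k+1] (suc (k + k)) k ⟨
  suc (k + k) C k + suc (k + k) C suc k                ≡⟨ cong (_+ suc (k + k) C suc k) symmetric ⟩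
  suc (k + k) C suc k + suc (k + k) C suc k            ≡⟨ cong (suc (k + k) C suc k +_) (+-identityʳ _) ⟨
  2 * (suc (k + k) C suc k)                            ∎
  where
  open ≡-Reasoning
  symmetric : suc (k + k) C k ≡ suc (k + k) C suc k
  symmetric = trans (nCk≡nC[n∸k] (m≤n⇒m≤1+n (m≤m+n k k))) (cong (suc (k + k) C_) (m+n∸n≡m (suc k) k))

central-recurrence : ∀ k → suc k * central (suc k) ≡ 2 * (suc (k + k) * central k)
central-recurrence k = begin
  suc k * central (suc k)                      ≡⟨ cong (suc k *_) (central-suc k) ⟩
  suc k * (2 * (suc (k + k) C suc k))          ≡⟨ swap (suc k) (suc (k + k) C suc k) ⟩
  2 * (suc k * (suc (k + k) C suc k))          ≡⟨ cong (2 *_) (C-absorption (k + k) k) ⟩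
  2 * (suc (k + k) * central k)                ∎
  where
  open ≡-Reasoning
  swap : ∀ x y → x * (2 * y) ≡ 2 * (x * y)
  swap = solve-∀

4^-double : ∀ k → 4 ^ (suc k + suc k) ≡ 16 * 4 ^ (k + k)
4^-double k = trans (cong (λ x → 4 ^ suc x) (+-suc k k)) (sym (*-assoc 4 4 (4 ^ (k + k))))

private
  -- Squaring keeps square roots out of the bounds; `z` stands for the linear factor of either bound
  -- at `suc k`.
  square-recurrence : ∀ k z → suc k * suc k * (central (suc k) * central (suc k) * z) ≡
                      4 * (suc (k + k) * suc (k + k) * z) * (central k * central k)
  square-recurrence k z = begin
    suc k * suc k * (central (suc k) * central (suc k) * z)
      ≡⟨ pair (suc k) (central (suc k)) z ⟩
    (suc k * central (suc k)) * (suc k * central (suc k)) * z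
      ≡⟨ cong (λ x → x * x * z) (central-recurrence k) ⟩
    2 * (suc (k + k) * central k) * (2 * (suc (k + k) * central k)) * z
      ≡⟨ unpair (suc (k + k)) (central k) z ⟩
    4 * (suc (k + k) * suc (k + k) * z) * (central k * central k) ∎
    where
    open ≡-Reasoning
    pair : ∀ a x z → a * a * (x * x * z) ≡ (a * x) * (a * x) * z
    pair = solve-∀
    unpair : ∀ b x z → 2 * (b * x) * (2 * (b * x)) * z ≡ 4 * (b * b * z) * (x * x)
    unpair = solve-∀

-- The true order is 16^k / (πk). With the factor 2k+1 the induction step reduces to (2k+1)(2k+3) ≤
-- 4(k+1)², which holds with 1 to spare.
central²-upper : ∀ k → central k * central k * suc (k + k) ≤ 4 ^ (k + k)
central²-upper zero    = ≤-refl
central²-upper (suc k) = *-cancelˡ-≤ (suc k * suc k) (begin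
  suc k * suc k * (central (suc k) * central (suc k) * suc (suc k + suc k))
    ≡⟨ square-recurrence k (suc (suc k + suc k)) ⟩
  4 * (suc (k + k) * suc (k + k) * suc (suc k + suc k)) * (central k * central k)
    ≡⟨ shuffle (suc (k + k)) (suc (suc k + suc k)) (central k) ⟩
  4 * (suc (k + k) * suc (suc k + suc k)) * (central k * central k * suc (k + k))
    ≤⟨ *-mono-≤ (≤-trans (m≤m+n _ 4) (≤-reflexive (estimate k))) (central²-upper k) ⟩
  suc k * suc k * 16 * 4 ^ (k + k)
    ≡⟨ *-assoc (suc k * suc k) 16 (4 ^ (k + k)) ⟩
  suc k * suc k * (16 * 4 ^ (k + k))
    ≡⟨ cong (suc k * suc k *_) (4^-double k) ⟨
  suc k * suc k * 4 ^ (suc k + suc k) ∎)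
  where
  open ≤-Reasoning
  shuffle : ∀ b z x → 4 * (b * b * z) * (x * x) ≡ 4 * (b * z) * (x * x * b)
  shuffle = solve-∀
  estimate : ∀ k → 4 * (suc (k + k) * suc (suc k + suc k)) + 4 ≡ suc k * suc k * 16
  estimate = solve-∀

-- With the factor 4k+1 the induction step reduces to 4(k+1)²(4k+1) ≤ (2k+1)²(4k+5), again with 1 to
-- spare.
central²-lower : ∀ k → 4 ^ (k + k) ≤ central k * central k * (4 * k + 1)
central²-lower zero    = ≤-refl
central²-lower (suc k) = *-cancelˡ-≤ (suc k * suc k) (begin
  suc k * suc k * 4 ^ (suc k + suc k)
    ≡⟨ cong (suc k * suc k *_) (4^-double k) ⟩
  suc k * suc k * (16 * 4 ^ (k + k))
    ≤⟨ *-monoʳ-≤ (suc k * suc k) (*-monoʳ-≤ 16 (central²-lower k)) ⟩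
  suc k * suc k * (16 * (central k * central k * (4 * k + 1)))
    ≡⟨ shuffle (suc k) (4 * k + 1) (central k * central k) ⟩
  (suc k * suc k * 16 * (4 * k + 1)) * (central k * central k)
    ≤⟨ *-monoˡ-≤ (central k * central k) (≤-trans (m≤m+n _ 4) (≤-reflexive (estimate k))) ⟩
  4 * (suc (k + k) * suc (k + k) * (4 * suc k + 1)) * (central k * central k)
    ≡⟨ square-recurrence k (4 * suc k + 1) ⟨
  suc k * suc k * (central (suc k) * central (suc k) * (4 * suc k + 1)) ∎)
  where
  open ≤-Reasoning
  shuffle : ∀ a z y → a * a * (16 * (y * z)) ≡ (a * a * 16 * z) * y
  shuffle = solve-∀
  estimate : ∀ k → suc k * suc k * 16 * (4 * k + 1) + 4 ≡ 4 * (suc (k + k) * suc (k + k) * (4 * suc k + 1))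
  estimate = solve-∀

data Halved : ℕ → Set where
  even : ∀ k → Halved (k + k)
  odd  : ∀ k → Halved (suc (k + k))

halve : ∀ n → Halved n
halve zero    = even 0
halve (suc n) with halve n
... | even k = odd k
... | odd  k = subst Halved (cong suc (+-suc k k)) (even (suc k))

C-half-even : ∀ k → (k + k) C ⌈ k + k /2⌉ ≡ central k
C-half-even k = cong ((k + k) C_) (sym (n≡⌈n+n/2⌉ k))

C-half-odd : ∀ k → 2 * (suc (k + k) C ⌈ suc (k + k) /2⌉) ≡ central (suc k)
C-half-odd k = trans (cong (λ x → 2 * (suc (k + k) C suc x)) (sym (n≡⌊n+n/2⌋ k))) (sym (central-suc k))

C-half²-upper : ∀ h → (h C ⌈ h /2⌉) * (h C ⌈ h /2⌉) * suc h ≤ 4 ^ h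
C-half²-upper h with halve h
... | even k rewrite C-half-even k = central²-upper k
... | odd  k = *-cancelˡ-≤ 4 (begin
  4 * (y * y * suc (suc (k + k)))                          ≡⟨ shuffle y _ ⟩
  2 * y * (2 * y) * suc (suc (k + k))                      ≡⟨ cong (λ x → x * x * suc (suc (k + k))) (C-half-odd k) ⟩
  central (suc k) * central (suc k) * suc (suc (k + k))
    ≤⟨ *-monoʳ-≤ (central (suc k) * central (suc k)) (s≤s (s≤s (+-monoʳ-≤ k (n≤1+n k)))) ⟩
  central (suc k) * central (suc k) * suc (suc k + suc k)  ≤⟨ central²-upper (suc k) ⟩
  4 ^ (suc k + suc k)                                      ≡⟨ cong (λ x → 4 ^ suc x) (+-suc k k) ⟩
  4 * 4 ^ suc (k + k)                                      ∎)
  where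
  open ≤-Reasoning
  y : ℕ
  y = suc (k + k) C ⌈ suc (k + k) /2⌉
  shuffle : ∀ y z → 4 * (y * y * z) ≡ 2 * y * (2 * y) * z
  shuffle = solve-∀

-- The factor 2h+3 is dictated by odd h = 2k+1, where doubling the coefficient gives
-- `central (suc k)` with factor 4(k+1)+1 = 2h+3.
C-half²-lower : ∀ h → 4 ^ h ≤ (h C ⌈ h /2⌉) * (h C ⌈ h /2⌉) * (2 * h + 3)
C-half²-lower h with halve h
... | even k rewrite C-half-even k =
  ≤-trans (central²-lower k) (*-monoʳ-≤ (central k * central k) (≤-trans (m≤m+n (4 * k + 1) 2) (≤-reflexive (weaken k))))
  where
  weaken : ∀ k → 4 * k + 1 + 2 ≡ 2 * (k + k) + 3
  weaken = solve-∀
... | odd  k = *-cancelˡ-≤ 4 (begin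
  4 * 4 ^ suc (k + k)                                      ≡⟨ cong (λ x → 4 ^ suc x) (+-suc k k) ⟨
  4 ^ (suc k + suc k)                                      ≤⟨ central²-lower (suc k) ⟩
  central (suc k) * central (suc k) * (4 * suc k + 1)      ≡⟨ cong (λ x → x * x * (4 * suc k + 1)) (C-half-odd k) ⟨
  2 * y * (2 * y) * (4 * suc k + 1)                        ≡⟨ shuffle y k ⟩
  4 * (y * y * (2 * suc (k + k) + 3))                      ∎)
  where
  open ≤-Reasoning
  y : ℕ
  y = suc (k + k) C ⌈ suc (k + k) /2⌉
  shuffle : ∀ y k → 2 * y * (2 * y) * (4 * suc k + 1) ≡ 4 * (y * y * (2 * suc (k + k) + 3))
  shuffle = solve-∀

-- MSTD sets as lists of integers

open import Data.Integer using (ℤ; +_)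
open import Data.Rational using (_/_)

module _ {A : Set} where
  unique-⊆⇒length≤ : ∀ {xs ys : List A} → Unique xs → xs List.⊆ ys → length xs ≤ length ys
  unique-⊆⇒length≤ {[]} [] xs⊆ys = z≤n
  unique-⊆⇒length≤ {x ∷ xs} (x∉xs ∷ uniq) xs⊆ys with as , bs , refl ← ∈-∃++ (xs⊆ys (here refl)) = begin
    suc (length xs)                   ≤⟨ s≤s (unique-⊆⇒length≤ uniq without-x) ⟩
    suc (length (as List.++ bs))      ≡⟨ cong suc (List.length-++ as) ⟩
    suc (length as + length bs)       ≡⟨ +-suc (length as) (length bs) ⟨
    length as + length (x ∷ bs)       ≡⟨ List.length-++ as ⟨
    length (as List.++ x ∷ bs)        ∎
    where
    open ≤-Reasoning
    without-x : xs List.⊆ as List.++ bs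
    without-x {y} y∈xs with ∈-++⁻ as (xs⊆ys (there y∈xs))
    ... | inj₁ y∈as         = ∈-++⁺ˡ y∈as
    ... | inj₂ (here refl)  = contradiction refl (All.lookup x∉xs y∈xs)
    ... | inj₂ (there y∈bs) = ∈-++⁺ʳ as y∈bs

elements⁺ : ∀ {n} {S : Subset n} {i} → χ S i ≡ true → + i ∈ₗ elements S
elements⁺ {n} {S} {i} eq = subst (λ j → + j ∈ₗ elements S) x≡i
  (∈-map⁺ (λ x → + toℕ x) (∈-filter⁺ (_∈? S) (∈-allFin (fromℕ< i<n)) (χ⇒∈ (subst (λ j → χ S j ≡ true) (sym x≡i) eq))))
  where
  i<n : i < n
  i<n = χ-< S eq
  x≡i : toℕ (fromℕ< i<n) ≡ i
  x≡i = toℕ-fromℕ< i<n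

elements⁻ : ∀ {n} {S : Subset n} {z} → z ∈ₗ elements S → ∃[ i ] (χ S i ≡ true × z ≡ + i)
elements⁻ {n} {S} z∈ with x , x∈ , refl ← ∈-map⁻ (λ x → + toℕ x) z∈ =
  toℕ x , ∈⇒χ (proj₂ (∈-filter⁻ (_∈? S) {xs = List.allFin n} x∈)) , refl

difference-injective : ∀ {i j k l} → + i ℤ.- + j ≡ + k ℤ.- + l → i + l ≡ k + j
difference-injective {i} {j} {k} {l} eq = ℤ.+-injective (begin
  + i ℤ.+ + l                          ≡⟨ lhs (+ i) (+ j) (+ l) ⟩
  + i ℤ.- + j ℤ.+ (+ j ℤ.+ + l)        ≡⟨ cong (ℤ._+ (+ j ℤ.+ + l)) eq ⟩
  + k ℤ.- + l ℤ.+ (+ j ℤ.+ + l)        ≡⟨ rhs (+ k) (+ j) (+ l) ⟩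
  + k ℤ.+ + j                          ∎)
  where
  open ≡-Reasoning
  lhs : ∀ x y z → x ℤ.+ z ≡ x ℤ.- y ℤ.+ (y ℤ.+ z)
  lhs = ℤ.solve-∀
  rhs : ∀ x y z → x ℤ.- z ℤ.+ (y ℤ.+ z) ≡ x ℤ.+ y
  rhs = ℤ.solve-∀

differences : ℕ → List ℤ
differences N = List.map (λ k → + k ℤ.- + N) (upTo (suc (2 * N)))

∈-differences : ∀ {N i j} → i ≤ N → j ≤ N → + i ℤ.- + j ∈ₗ differences N
∈-differences {N} {i} {j} i≤N j≤N = subst (_∈ₗ differences N) (sym shifted)
  (∈-map⁺ (λ k → + k ℤ.- + N) (∈-upTo⁺ (s≤s (+-mono-≤ i≤N (≤-trans (m∸n≤m N j) (m≤m+n N 0))))))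
  where
  shift : ∀ x y z → x ℤ.- y ≡ x ℤ.+ z ℤ.- (y ℤ.+ z)
  shift = ℤ.solve-∀
  shifted : + i ℤ.- + j ≡ + (i + (N ∸ j)) ℤ.- + N
  shifted = trans (shift (+ i) (+ j) (+ (N ∸ j))) (cong (λ M → + (i + (N ∸ j)) ℤ.- + M) (m+[n∸m]≡n j≤N))

-- In the application `suc N` is n-1 and `suc d` is n-7. Writing the missing difference as a
-- successor makes it nonzero, so that its two signs count separately.
module _ {n : ℕ} (p : Subset n) (N d : ℕ)
         (≤1+N : ∀ {i} → χ p i ≡ true → i ≤ suc N)
         (every-sum : ∀ {k} → k ≢ 1 → k ≤ 2 * suc N → ∃[ i ] ∃[ j ] (χ p i ≡ true × χ p j ≡ true × i + j ≡ k))
         (d≤N : d ≤ N) (no-difference : ∀ {i j} → χ p i ≡ true → χ p j ≡ true → i ≢ j + suc d)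
         where
  private
    S : List ℤ
    S = elements p

    sums : List ℤ
    sums = + 0 ∷ List.map (λ i → + (2 + i)) (upTo (suc (2 * N)))

  many-sums : 2 * suc N ≤ card (S ⊕ S)
  many-sums = begin
    2 * suc N          ≡⟨ split N ⟩
    2 + 2 * N      ≡⟨ cong suc (trans (List.length-map (λ i → + (2 + i)) (upTo (suc (2 * N)))) (List.length-upTo _)) ⟨
    length sums           ≤⟨ unique-⊆⇒length≤ unique (∈-deduplicate⁺ ℤ._≟_ ∘ included) ⟩
    card (S ⊕ S)          ∎
    where
    open ≤-Reasoning
    split : ∀ N → 2 * suc N ≡ 2 + 2 * N
    split = solve-∀
    unique : Unique sums
    unique = All.map⁺ (All.tabulate λ _ ()) ∷ Unique.map⁺ (λ eq → +-cancelˡ-≡ 2 _ _ (ℤ.+-injective eq)) (Unique.upTo⁺ _)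
    sum∈ : ∀ {k} → k ≢ 1 → k ≤ 2 * suc N → + k ∈ₗ S ⊕ S
    sum∈ k≢1 k≤ with i , j , s-i , s-j , refl ← every-sum k≢1 k≤ =
      ∈-cartesianProductWith⁺ ℤ._+_ (elements⁺ {S = p} {i} s-i) (elements⁺ {S = p} {j} s-j)
    included : sums List.⊆ S ⊕ S
    included (here refl) = sum∈ (λ ()) z≤n
    included (there z∈) with i , i∈ , refl ← ∈-map⁻ (λ i → + (2 + i)) z∈ =
      sum∈ (λ ()) (≤-trans (+-monoʳ-≤ 2 (s≤s⁻¹ (∈-upTo⁻ i∈))) (≤-reflexive (sym (split N))))

  -- Adjoining the two missing differences to the distinct differences of S still gives a
  -- repetition-free list within [-(N+1), N+1], which has 2(N+1)+1 elements.
  few-differences : suc (card (S ⊖ S)) ≤ 2 * suc N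
  few-differences = s≤s⁻¹ (begin
    length missing+         ≤⟨ unique-⊆⇒length≤ unique included ⟩
    length (differences (suc N))
      ≡⟨ trans (List.length-map (λ k → + k ℤ.- + (suc N)) (upTo (suc (2 * suc N)))) (List.length-upTo _) ⟩
    suc (2 * suc N)      ∎)
    where
    open ≤-Reasoning
    -- Both are written as differences of naturals, so that `difference-injective` and
    -- `∈-differences` apply to them directly.
    high low : ℤ
    high = + (suc d) ℤ.- + 0
    low  = + 0 ℤ.- + (suc d)
    missing+ : List ℤ
    missing+ = high ∷ low ∷ deduplicate ℤ._≟_ (S ⊖ S)

    difference⁻ : ∀ {z} → z ∈ₗ S ⊖ S → ∃[ i ] ∃[ j ] (χ p i ≡ true × χ p j ≡ true × z ≡ + i ℤ.- + j)
    difference⁻ z∈ with x , y , x∈ , y∈ , refl ← ∈-cartesianProductWith⁻ ℤ._-_ S S z∈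
      with i , s-i , refl ← elements⁻ {S = p} x∈ | j , s-j , refl ← elements⁻ {S = p} y∈
      = i , j , s-i , s-j , refl

    high∉ : high ∉ₗ S ⊖ S
    high∉ z∈ with i , j , s-i , s-j , eq ← difference⁻ z∈ =
      no-difference {i} {j} s-i s-j (trans (sym (+-identityʳ i)) (trans (sym (difference-injective {suc d} {0} {i} {j} eq)) (+-comm (suc d) j)))

    low∉ : low ∉ₗ S ⊖ S
    low∉ z∈ with i , j , s-i , s-j , eq ← difference⁻ z∈ =
      no-difference {j} {i} s-j s-i (difference-injective {0} {suc d} {i} {j} eq)

    high≢low : high ≢ low
    high≢low eq with () ← difference-injective {suc d} {0} {0} {suc d} eq

    ∉⇒All≢ : ∀ {z} → z ∉ₗ S ⊖ S → All (z ≢_) (deduplicate ℤ._≟_ (S ⊖ S))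
    ∉⇒All≢ z∉ = All.tabulate λ y∈ z≡y → z∉ (subst (_∈ₗ S ⊖ S) (sym z≡y) (∈-deduplicate⁻ ℤ._≟_ (S ⊖ S) y∈))

    unique : Unique missing+
    unique = (high≢low ∷ ∉⇒All≢ high∉) ∷ ∉⇒All≢ low∉ ∷ deduplicate-! (S ⊖ S)

    included : missing+ List.⊆ differences (suc N)
    included (here refl)         = ∈-differences (s≤s d≤N) z≤n
    included (there (here refl)) = ∈-differences z≤n (s≤s d≤N)
    included (there (there z∈))
      with i , j , s-i , s-j , refl ← difference⁻ (∈-deduplicate⁻ ℤ._≟_ (S ⊖ S) z∈)
      = ∈-differences (≤1+N {i} s-i) (≤1+N {j} s-j)

  sums-without-1⇒MSTD : MSTD S
  sums-without-1⇒MSTD = ≤-trans few-differences many-sums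

fringed-MSTD : ∀ {m} (v : Vec Bool m) → PrefixMajority v → SuffixMajority v → MSTD (elements (fringed v))
fringed-MSTD {m} v pre suf = sums-without-1⇒MSTD (fringed v) (m + 20) (m + 14)
  (λ {i} s-i → s≤s⁻¹ (subst (i <_) (n≡ m) (χ-< (fringed v) {i} s-i)))
  (λ {k} k≢1 k≤ → every-sum k≢1 (subst (λ N → k ≤ 2 * N) (sym (+-suc m 20)) k≤))
  (+-monoʳ-≤ m (m≤m+n 14 6))
  (λ {i} {j} s-i s-j i≡ → no-difference {i} {j} s-i s-j (trans i≡ (cong (λ x → j + x) (sym (+-suc m 14)))))
  where
  open Sums v pre suf
  n≡ : ∀ m → 11 + (m + 11) ≡ 2 + (m + 20)
  n≡ = solve-∀

span-surjective : ∀ {n} → 24 ≤ n → ∃[ m ] (2 ≤ m × n ≡ span m)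
span-surjective {n} 24≤n =
  n ∸ 22 , ∸-monoˡ-≤ 22 24≤n , trans (sym (m∸n+n≡m (≤-trans (m≤n+m 22 2) 24≤n))) (sym (span≡ (n ∸ 22)))

obtained⁻ : ∀ {m} {S : Subset (span m)} → Obtained S →
            ∃[ v ] (S ≡ fringed {m} v × PrefixMajority v × SuffixMajority v)
obtained⁻ {m} {S} (M , M⊆ , psp , S≡) = v , trans S≡ union≡ , psp⇒majorities v (subst PrefixSuffixProperty M≡ psp)
  where
  v : Vec Bool m
  v = proj₁ (⊆middle⇒padded m M⊆)
  M≡ : M ≡ padded v
  M≡ = proj₂ (⊆middle⇒padded m M⊆)
  union≡ : L (span m) ∪ M ∪ R (span m) ≡ fringed v
  union≡ = trans (cong (λ M → L (span m) ∪ M ∪ R (span m)) M≡) (fringed≡ v)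

obtained⁺ : ∀ {m} (v : Vec Bool m) → PrefixMajority v → SuffixMajority v → Obtained (fringed v)
obtained⁺ v pre suf = padded v , padded⊆middle v , majorities⇒psp v pre suf , sym (fringed≡ v)

union-MSTD : ∀ m (M : Subset (span m)) → M ⊆ middle (span m) → PrefixSuffixProperty M →
             MSTD (elements (L (span m) ∪ M ∪ R (span m)))
union-MSTD m M M⊆ psp = let v , eq , pre , suf = obtained⁻ {m} (M , M⊆ , psp , refl) in
  subst (λ S → MSTD (elements S)) (sym eq) (fringed-MSTD v pre suf)

-- Asymptotics

bidirectionals : ℕ → ℕ
bidirectionals m = count (bidirectional? {m})

-- A vector satisfying `P` has both frames forced, and cancelling them recovers its middle uniquely,
-- so only the middle is counted.
count-framed : ∀ {a m b} (l : Vec Bool a) (r : Vec Bool b) {P : Vec Bool (a + (m + b)) → Set} {Q : Vec Bool m → Set}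
               (P? : Decidable P) (Q? : Decidable Q) →
               (∀ u → P u → ∃[ v ] (u ≡ l ++ (v ++ r) × Q v)) → (∀ v → Q v → P (l ++ (v ++ r))) →
               count P? ≡ count Q?
count-framed {m = m} l r {P} {Q} P? Q? to from = begin
  count P?                           ≡⟨ count-++ˡ P? l (λ u p → let v , eq , _ = to u p in v ++ r , eq) ⟩
  count (λ u → P? (l ++ u))          ≡⟨ count-++ʳ {m} (λ u → P? (l ++ u)) r
                                          (λ u p → let v , eq , _ = to (l ++ u) p in v , ++-injectiveʳ l l eq) ⟩
  count {m} (λ v → P? (l ++ (v ++ r)))  ≡⟨ count-cong {m} (λ v → P? (l ++ (v ++ r))) Q? to′ from ⟩
  count Q?                           ∎
  where
  open ≡-Reasoning
  to′ : ∀ v → P (l ++ (v ++ r)) → Q v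
  to′ v p = let w , eq , q = to _ p in subst Q (sym (++-injectiveˡ v w (++-injectiveʳ l l eq))) q

obtainedMSTD? : ∀ {n} (S : Subset n) → Dec (MSTD (elements S) × Obtained S)
obtainedMSTD? S = MSTD? (elements S) ×-dec obtained? S

numberObtained-count : ∀ n → numberObtained n ≡ count (obtainedMSTD? {n})
numberObtained-count n = length-filter-allSubsets {n} obtainedMSTD?

-- Distinct `v` give distinct `fringed v`, so counting the sets S agrees with counting the
-- admissible middles; the MSTD component in `from` is the first half of the theorem.
numberObtained≡ : ∀ m → numberObtained (span m) ≡ bidirectionals m
numberObtained≡ m = trans (numberObtained-count (span m))
  (count-framed {11} {m} {11} leftFringe rightFringe (obtainedMSTD? {span m}) (bidirectional? {m}) to from)
  where
  to : ∀ S → MSTD (elements S) × Obtained S → ∃[ v ] (S ≡ fringed v × PrefixMajority v × SuffixMajority v)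
  to S (_ , obtained) = obtained⁻ {m} obtained
  from : ∀ v → PrefixMajority v × SuffixMajority v → MSTD (elements (fringed v)) × Obtained (fringed v)
  from v (pre , suf) = fringed-MSTD v pre suf , obtained⁺ v pre suf

4^h≡2^h*2^h : ∀ h → 4 ^ h ≡ 2 ^ h * 2 ^ h
4^h≡2^h*2^h h = trans (^-*-assoc 2 2 h) (trans (cong (2 ^_) (cong (λ x → h + x) (+-identityʳ h))) (^-distribˡ-+-* 2 h h))

-- One factor of 4^h = 2^h * 2^h cancels against the 2^(h+1) in Harris' inequality, leaving the
-- factor 2.
bidirectionals-lower : ∀ h → 2 ^ h ≤ 2 * bidirectionals (suc h) * (2 * h + 3)
bidirectionals-lower h = *-cancelˡ-≤ (2 ^ h) {{m^n≢0 2 h}} (begin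
  2 ^ h * 2 ^ h                                       ≡⟨ 4^h≡2^h*2^h h ⟨
  4 ^ h                                               ≤⟨ C-half²-lower h ⟩
  (h C ⌈ h /2⌉) * (h C ⌈ h /2⌉) * (2 * h + 3)         ≡⟨ cong (λ x → x * x * (2 * h + 3)) (ballots≡C h) ⟨
  ballots (suc h) * ballots (suc h) * (2 * h + 3)     ≤⟨ *-monoˡ-≤ (2 * h + 3) (ballots²≤ (suc h)) ⟩
  2 ^ suc h * bidirectionals (suc h) * (2 * h + 3)    ≡⟨ shuffle (2 ^ h) (bidirectionals (suc h)) (2 * h + 3) ⟩
  2 ^ h * (2 * bidirectionals (suc h) * (2 * h + 3))  ∎)
  where
  open ≤-Reasoning
  shuffle : ∀ p b z → 2 * p * b * z ≡ p * (2 * b * z)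
  shuffle = solve-∀

bidirectionals-upper : ∀ h c → let a = suc h in a * bidirectionals (a + (c + a)) ≤ 2 ^ c * 4 ^ h
bidirectionals-upper h c = begin
  suc h * bidirectionals (suc h + (c + suc h))              ≤⟨ *-monoʳ-≤ (suc h) (bidirectional≤ (suc h) c) ⟩
  suc h * (ballots (suc h) * (2 ^ c * ballots (suc h)))     ≡⟨ cong (λ x → suc h * (x * (2 ^ c * x))) (ballots≡C h) ⟩
  suc h * (x * (2 ^ c * x))                                 ≡⟨ shuffle (suc h) x (2 ^ c) ⟩
  2 ^ c * (x * x * suc h)                                   ≤⟨ *-monoʳ-≤ (2 ^ c) (C-half²-upper h) ⟩
  2 ^ c * 4 ^ h                                             ∎
  where
  open ≤-Reasoning
  x : ℕ
  x = h C ⌈ h /2⌉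
  shuffle : ∀ a x y → a * (x * (y * x)) ≡ y * (x * x * a)
  shuffle = solve-∀

numberObtained-lower : ∀ {n} → 24 ≤ n → 2 ^ n ≤ numberObtained n * n * 2 ^ 25
numberObtained-lower {n} 24≤n = go (span-surjective 24≤n)
  where
  shuffle : ∀ b z p → 2 * (2 * b * (2 * z)) * p ≡ b * z * (2 * (2 * (2 * p)))
  shuffle = solve-∀
  room : ∀ h e → 2 * h + 3 + (2 * e + 1) ≡ 2 * (suc h + suc e)
  room = solve-∀
  -- With `suc e` = 22 the power is 2^25: 2^22 for the fringe positions, and three factors 2, from
  -- 2^(h+1) against 2^h, from `bidirectionals-lower`, and from 2h+3 ≤ 2n.
  main : ∀ h e → 2 ^ (suc h + suc e) ≤ bidirectionals (suc h) * (suc h + suc e) * 2 ^ (3 + suc e)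
  main h e = begin
    2 ^ (suc h + suc e)                                        ≡⟨ ^-distribˡ-+-* 2 (suc h) (suc e) ⟩
    2 * 2 ^ h * 2 ^ suc e
      ≤⟨ *-monoˡ-≤ (2 ^ suc e) (*-monoʳ-≤ 2 (≤-trans (bidirectionals-lower h)
           (*-monoʳ-≤ (2 * bidirectionals (suc h)) (≤-trans (m≤m+n (2 * h + 3) (2 * e + 1)) (≤-reflexive (room h e)))))) ⟩
    2 * (2 * bidirectionals (suc h) * (2 * (suc h + suc e))) * 2 ^ suc e
      ≡⟨ shuffle (bidirectionals (suc h)) (suc h + suc e) (2 ^ suc e) ⟩
    bidirectionals (suc h) * (suc h + suc e) * 2 ^ (3 + suc e) ∎
    where open ≤-Reasoning
  go : ∃[ m ] (2 ≤ m × n ≡ span m) → 2 ^ n ≤ numberObtained n * n * 2 ^ 25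
  go (suc h , _ , n≡) = subst₂ (λ b x → 2 ^ x ≤ b * x * 2 ^ 25)
    (sym (trans (cong numberObtained n≡) (numberObtained≡ (suc h)))) (sym (trans n≡ (span≡ (suc h)))) (main h 21)

numberObtained-upper : ∀ {n} → 24 ≤ n → numberObtained n * n ≤ 2 ^ n
numberObtained-upper {n} 24≤n = let m , 2≤m , n≡ = span-surjective 24≤n in
  subst₂ (λ b x → b * x ≤ 2 ^ x) (sym (trans (cong numberObtained n≡) (numberObtained≡ m))) (sym (trans n≡ (span≡ m)))
    (by-parity m 2≤m)
  where
  -- Since a ≥ 1, m + 22 ≤ 2a + 23 ≤ 25a. The factor 25 is absorbed by 2^24: 2^22 from the fringe
  -- positions and 4 from 4^h = 4^a / 4.
  main : ∀ h c → c ≤ 1 → let a = suc h; m = a + (c + a) in bidirectionals m * (m + 22) ≤ 2 ^ (m + 22)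
  main h c c≤1 = begin
    bidirectionals ℓ * (ℓ + 22)                    ≤⟨ *-monoʳ-≤ (bidirectionals ℓ) ℓ+22≤ ⟩
    bidirectionals ℓ * (a * 25)                    ≡⟨ shuffle (bidirectionals ℓ) a 25 ⟩
    a * bidirectionals ℓ * 25                      ≤⟨ *-monoˡ-≤ 25 (bidirectionals-upper h c) ⟩
    2 ^ c * 4 ^ h * 25                             ≤⟨ *-monoʳ-≤ (2 ^ c * 4 ^ h) (≤-trans (m≤m+n 25 7) (^-monoʳ-≤ 2 (m≤m+n 5 19))) ⟩
    2 ^ c * 4 ^ h * 2 ^ 24                         ≡⟨ cong (λ x → 2 ^ c * x * 2 ^ 24) (4^h≡2^h*2^h h) ⟩
    2 ^ c * (2 ^ h * 2 ^ h) * 2 ^ 24               ≡⟨ regroup (2 ^ c) (2 ^ h) (2 ^ 22) ⟩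
    2 ^ a * (2 ^ c * 2 ^ a) * 2 ^ 22               ≡⟨ cong (λ x → 2 ^ a * x * 2 ^ 22) (^-distribˡ-+-* 2 c a) ⟨
    2 ^ a * 2 ^ (c + a) * 2 ^ 22                   ≡⟨ cong (_* 2 ^ 22) (^-distribˡ-+-* 2 a (c + a)) ⟨
    2 ^ ℓ * 2 ^ 22                                 ≡⟨ ^-distribˡ-+-* 2 ℓ 22 ⟨
    2 ^ (ℓ + 22)                                   ∎
    where
    open ≤-Reasoning
    a ℓ : ℕ
    a = suc h
    ℓ = a + (c + a)
    shuffle : ∀ b a k → b * (a * k) ≡ a * b * k
    shuffle = solve-∀
    regroup : ∀ x y z → x * (y * y) * (2 * (2 * z)) ≡ 2 * y * (x * (2 * y)) * z
    regroup = solve-∀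
    room : ∀ h → suc h + (1 + suc h) + 22 + 23 * h ≡ suc h * 25
    room = solve-∀
    ℓ+22≤ : ℓ + 22 ≤ a * 25
    ℓ+22≤ = ≤-trans (+-monoˡ-≤ 22 (+-monoʳ-≤ a (+-monoˡ-≤ a c≤1))) (≤-trans (m≤m+n _ (23 * h)) (≤-reflexive (room h)))
  by-parity : ∀ m → 2 ≤ m → bidirectionals m * (m + 22) ≤ 2 ^ (m + 22)
  by-parity m 2≤m with halve m
  ... | even (suc h) = main h 0 z≤n
  ... | odd  (suc h) = subst (λ m → bidirectionals m * (m + 22) ≤ 2 ^ (m + 22)) (+-suc (suc h) (suc h)) (main h 1 ≤-refl)
  by-parity m () | even zero
  by-parity m (s≤s ()) | odd zero

-- From inequalities of naturals to Θ over the rationals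

toℚᵘ-/ : ∀ p q .{{_ : NonZero q}} → ℚ.toℚᵘ (+ p / q) ℚᵘ.≃ mkℚᵘ (+ p) (pred q)
toℚᵘ-/ p (suc q) = ℚ.toℚᵘ-fromℚᵘ (mkℚᵘ (+ p) q)

mkℚᵘ-≤ : ∀ {p q r s} → p * suc s ≤ r * suc q → mkℚᵘ (+ p) q ℚᵘ.≤ mkℚᵘ (+ r) s
mkℚᵘ-≤ {p} {q} {r} {s} le = *≤* (subst₂ ℤ._≤_ (ℤ.pos-* p (suc s)) (ℤ.pos-* r (suc q)) (ℤ.+≤+ le))

-- Unnormalised fractions keep numerator and denominator explicit, so comparing them is
-- cross-multiplication and no gcd appears. The `pred` reflects that `mkℚᵘ` stores the denominator
-- minus one.
toℚᵘ-/* : ∀ p q r s .{{_ : NonZero q}} .{{_ : NonZero s}} →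
          ℚ.toℚᵘ ((+ p / q) ℚ.* (+ r / s)) ℚᵘ.≃ mkℚᵘ (+ (p * r)) (pred (q * s))
toℚᵘ-/* p (suc q) r (suc s) = begin
  ℚ.toℚᵘ ((+ p / suc q) ℚ.* (+ r / suc s))               ≈⟨ ℚ.toℚᵘ-homo-* (+ p / suc q) (+ r / suc s) ⟩
  ℚ.toℚᵘ (+ p / suc q) ℚᵘ.* ℚ.toℚᵘ (+ r / suc s)         ≈⟨ ℚᵘ.*-cong (toℚᵘ-/ p (suc q)) (toℚᵘ-/ r (suc s)) ⟩
  mkℚᵘ (+ p) q ℚᵘ.* mkℚᵘ (+ r) s                         ≡⟨ cong (λ x → mkℚᵘ x (pred (suc q * suc s))) (ℤ.pos-* p r) ⟨
  mkℚᵘ (+ (p * r)) (pred (suc q * suc s))                ∎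
  where open import Relation.Binary.Reasoning.Setoid ℚᵘ.≃-setoid

/*-≤ : ∀ p q r s t .{{_ : NonZero q}} .{{_ : NonZero s}} → p * r ≤ t * (q * s) → (+ p / q) ℚ.* (+ r / s) ℚ.≤ + t / 1
/*-≤ p (suc q) r (suc s) t le = ℚ.toℚᵘ-cancel-≤ (begin
  ℚ.toℚᵘ ((+ p / suc q) ℚ.* (+ r / suc s))        ≃⟨ toℚᵘ-/* p (suc q) r (suc s) ⟩
  mkℚᵘ (+ (p * r)) (pred (suc q * suc s))         ≤⟨ mkℚᵘ-≤ (subst (_≤ t * (suc q * suc s)) (sym (*-identityʳ (p * r))) le) ⟩
  mkℚᵘ (+ t) 0                                    ≃⟨ toℚᵘ-/ t 1 ⟨
  ℚ.toℚᵘ (+ t / 1)                                ∎)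
  where open ℚᵘ.≤-Reasoning

≤-/* : ∀ p q r s t .{{_ : NonZero q}} .{{_ : NonZero s}} → t * (q * s) ≤ p * r → + t / 1 ℚ.≤ (+ p / q) ℚ.* (+ r / s)
≤-/* p (suc q) r (suc s) t le = ℚ.toℚᵘ-cancel-≤ (begin
  ℚ.toℚᵘ (+ t / 1)                                ≃⟨ toℚᵘ-/ t 1 ⟩
  mkℚᵘ (+ t) 0                                    ≤⟨ mkℚᵘ-≤ (subst (t * (suc q * suc s) ≤_) (sym (*-identityʳ (p * r))) le) ⟩
  mkℚᵘ (+ (p * r)) (pred (suc q * suc s))         ≃⟨ toℚᵘ-/* p (suc q) r (suc s) ⟨
  ℚ.toℚᵘ ((+ p / suc q) ℚ.* (+ r / suc s))        ∎)
  where open ℚᵘ.≤-Reasoning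

/-positive : ∀ p q .{{_ : NonZero p}} .{{_ : NonZero q}} → ℚ.0ℚ ℚ.< + p / q
/-positive p q = ℚ.positive⁻¹ (+ p / q) {{ℚ.normalize-pos p q}}

-- With constants 1/c and d, clearing denominators turns the two rational bounds into the two
-- hypotheses.
=Θ-/ : ∀ (f g : ℕ → ℕ) c d N .{{_ : NonZero c}} .{{_ : NonZero d}} →
       (∀ n → N ≤ n → g n ≤ f n * n * c) → (∀ n → N ≤ n → f n * n ≤ d * g n) →
       (λ n → + f n / 1) =Θ (λ n → + g n / n)
=Θ-/ f g c d N lower upper = + 1 / c , + d / 1 , N , /-positive 1 c , /-positive d 1 , λ n N≤n →
    /*-≤ 1 c (g n) n (f n) (≤-trans (≤-reflexive (*-identityˡ (g n))) (≤-trans (lower n N≤n) (≤-reflexive (shuffle (f n) n c))))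
  , ≤-/* d 1 (g n) n (f n) (≤-trans (≤-reflexive (cong (λ x → f n * x) (*-identityˡ n))) (upper n N≤n))
  where
  shuffle : ∀ f n c → f * n * c ≡ f * (c * n)
  shuffle = solve-∀

theorem2 : (∀ n → 24 ≤ n → (M : Subset n) → M ⊆ middle n → PrefixSuffixProperty M →
    MSTD (elements (L n ∪ M ∪ R n)))
    × ((λ n → + numberObtained n / 1) =Θ (λ n → + (2 ^ n) / n))
theorem2 = (λ n 24≤n → mstd n (span-surjective 24≤n))
         , =Θ-/ numberObtained (2 ^_) (2 ^ 25) 1 24 (λ n → numberObtained-lower)
             -- `1 * 2 ^ n` unfolds to `2 ^ n + 0`.
             (λ n 24≤n → ≤-trans (numberObtained-upper 24≤n) (m≤m+n (2 ^ n) 0))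
  where
  mstd : ∀ n → ∃[ m ] (2 ≤ m × n ≡ span m) → (M : Subset n) → M ⊆ middle n → PrefixSuffixProperty M →
         MSTD (elements (L n ∪ M ∪ R n))
  mstd n (m , _ , refl) = union-MSTD m
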